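{- Let $k\ge 1$ be a fixed integer and let $A$ be an alphabet with $k$ letters. For the uniform distribution over the accessible, deterministic and complete automata with $n$ states over $A$, the average time complexity of Moore's state minimization algorithm is $\mathcal{O}(n\log n)$ as $n\to\infty$. That is, if $\mathcal{A}_n$ denotes the (finite) set of accessible, deterministic and complete automata with $n$ states over $A$ and $\mathcal{W}(\mathcal{A})$ denotes the running time of Moore's algorithm on input $\mathcal{A}$, then $$\frac{1}{|\mathcal{A}_n|}\sum_{\mathcal{A}\in\mathcal{A}_n}\mathcal{W}(\mathcal{A})=\mathcal{O}(n\log n).$$
   Context: A (finite, complete, deterministic) automaton is a quintuple $\mathcal{A}=(A,Q,\cdot,q_0,F)$ with $Q$ a finite set of states, $A$ a finite alphabet, a total transition function $\cdot:Q\times A\to Q$, an initial state $q_0\in Q$, and a set of final states $F\subseteq Q$ (any subset, possibly empty or equal to $Q$). The transition function is extended to words by $p\cdot\varepsilon=p$ and $p\cdot(uv)=(p\cdot u)\cdot v$. The automaton is accessible if for every $p\in Q$ there is a word $u\in A^*$ with $q_0\cdot u=p$. Automata with $n$ states have $Q=\{1,\dots,n\}$. Automata may be identified up to renaming of states: since accessible deterministic automata have no nontrivial automorphism, this does not affect averages. For a Boolean condition, $[\![\mathrm{Cond}]\!]$ is $1$ if the condition holds and $0$ otherwise. Moore's algorithm on input $\mathcal{A}=(A,\{1,\dots,n\},\cdot,q_0,F)$ with $A=\{a_1,\dots,a_k\}$: (1) If $F=\emptyset$ or $F=\{1,\dots,n\}$, return the corresponding one-state automaton (with no final state, respectively with its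 single state final). (2) Otherwise set $\pi'[p]=[\![p\in F]\!]$ for every state $p$, and let $\pi$ be undefined. (3) Main loop: while $\pi\ne\pi'$ as partitions of the set of states, set $\pi=\pi'$ and compute the new partition $\pi'$ such that $\pi'[p]=\pi'[q]$ if and only if $\pi[p]=\pi[q]$ and $\pi[p\cdot a]=\pi[q\cdot a]$ for all $a\in A$. This computation is done by associating to each state $p$ the $(k+1)$-tuple $s[p]=(\pi[p],\pi[p\cdot a_1],\dots,\pi[p\cdot a_k])$, sorting the states by their tuples with a lexicographic (radix/bucket) sort, and giving successive integer labels to the groups of states having equal tuples. (4) Return the quotient of $\mathcal{A}$ by the partition $\pi$. Running time is counted in elementary operations on a unit-cost RAM, with $k$ fixed. -}

module Defs where

open import Data.Bool.Base using (Bool; true; false; if_then_else_; _∧_)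
open import Data.Fin.Base as Fin using (Fin; toℕ; fromℕ<)
open import Data.Fin.Properties as Finₚ using (any?; all?; pigeonhole; toℕ<n)
open import Data.Fin.Subset using (Subset; inside; outside)
open import Data.Integer.Base using (+_)
open import Data.List.Base as List
  using (List; []; _∷_; _++_; length; map; filter; allFin; cartesianProductWith)
open import Data.List.Membership.Propositional using (_∈_)
open import Data.List.Membership.Propositional.Properties
  using (∈-cartesianProductWith⁺; ∈-allFin; ∈-filter⁺; ∈-filter⁻)
open import Data.List.Properties using (foldl-++; take++drop≡id; length-++; length-take; length-drop)
open import Data.List.Relation.Unary.All as All using ([]; _∷_)
open import Data.List.Relation.Unary.AllPairs using ([]; _∷_)
open import Data.List.Relation.Unary.Any using (here; there)
open import Data.List.Relation.Unary.Unique.Propositional using (Unique)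
import Data.List.Relation.Unary.Unique.Propositional.Properties as Uniqueₚ
open import Data.Nat.Base
open import Data.Nat.ListAction using (sum)
open import Data.Nat.Induction using (<-wellFounded; Acc; acc)
open import Data.Nat.Properties
open import Data.Product.Base using (Σ-syntax; ∃-syntax; _×_; _,_; proj₁; proj₂)
open import Data.Rational.Base as ℚ using (ℚ; 0ℚ)
open import Data.Sum.Base using (_⊎_; inj₁; inj₂)
open import Data.Vec.Base as Vec using (Vec; []; _∷_; lookup)
open import Function.Base using (_∘_)
open import Relation.Binary.PropositionalEquality hiding ([_])
open import Relation.Nullary.Decidable using (Dec; yes; no; map′; _⊎-dec_)
open import Relation.Nullary.Negation using (contradiction)

------------------------------------------------------------------------
-- Automata with state set Fin n over the alphabet Fin k

Word : ℕ → Set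
Word k = List (Fin k)

-- Tables rather than functions, so that equal automata are propositionally
-- equal and there are finitely many of them.
record Automaton (k n : ℕ) : Set where
  constructor automaton
  field
    δ     : Vec (Vec (Fin n) k) n
    start : Fin n
    final : Subset n

  infixl 7 _·_ _·*_

  _·_ : Fin n → Fin k → Fin n
  p · a = lookup (lookup δ p) a

  _·*_ : Fin n → Word k → Fin n
  _·*_ = List.foldl _·_

  Accessible : Set
  Accessible = ∀ p → ∃[ u ] start ·* u ≡ p

open Automaton using (Accessible)

-- Every reachable state is reached by a word of length at most n, which makes
-- accessibility decidable.
module _ {k n : ℕ} (𝒜 : Automaton k n) where
  open Automaton 𝒜 using (start; _·_; _·*_)

  reach≤? : ∀ m p q → Dec (∃[ u ] length u ≤ m × p ·* u ≡ q)
  reach≤? zero p q = map′ (λ eq → [] , z≤n , eq) (λ { ([] , _ , eq) → eq }) (p Finₚ.≟ q)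
  reach≤? (suc m) p q =
    map′ to from ((p Finₚ.≟ q) ⊎-dec any? (λ a → reach≤? m (p · a) q))
    where
    to : p ≡ q ⊎ (∃[ a ] ∃[ u ] length u ≤ m × p · a ·* u ≡ q) →
         ∃[ u ] length u ≤ suc m × p ·* u ≡ q
    to (inj₁ eq)                = [] , z≤n , eq
    to (inj₂ (a , u , |u| , eq)) = a ∷ u , s≤s |u| , eq

    from : ∃[ u ] length u ≤ suc m × p ·* u ≡ q →
           p ≡ q ⊎ (∃[ a ] ∃[ u ] length u ≤ m × p · a ·* u ≡ q)
    from ([]    , _        , eq) = inj₁ eq
    from (a ∷ u , s≤s |u| , eq) = inj₂ (a , u , |u| , eq)

  shorten : ∀ p u → Acc _<_ (length u) → ∃[ v ] length v ≤ n × p ·* v ≡ p ·* u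
  shorten p u (acc rec) with length u ≤? n
  ... | yes |u|≤n = u , |u|≤n , refl
  ... | no  |u|≰n
    with i , j , i<j , eq ← pigeonhole (n<1+n n) (λ (i : Fin (suc n)) → p ·* List.take (toℕ i) u)
    = let v , |v|≤n , v≡w = shorten p w (rec |w|<|u|) in v , |v|≤n , trans v≡w w≡u
    where
    open ≡-Reasoning
    u₁ = List.take (toℕ i) u
    u₂ = List.take (toℕ j) u
    u₃ = List.drop (toℕ j) u
    w  = u₁ ++ u₃

    w≡u : p ·* w ≡ p ·* u
    w≡u = begin
      p ·* (u₁ ++ u₃)  ≡⟨ foldl-++ _·_ p u₁ u₃ ⟩
      p ·* u₁ ·* u₃    ≡⟨ cong (_·* u₃) eq ⟩
      p ·* u₂ ·* u₃    ≡⟨ foldl-++ _·_ p u₂ u₃ ⟨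
      p ·* (u₂ ++ u₃)  ≡⟨ cong (p ·*_) (take++drop≡id (toℕ j) u) ⟩
      p ·* u           ∎

    j≤|u| : toℕ j ≤ length u
    j≤|u| = ≤-trans (s≤s⁻¹ (toℕ<n j)) (<⇒≤ (≰⇒> |u|≰n))

    |w|<|u| : length w < length u
    |w|<|u| = ≤-<-trans
      (≤-reflexive (trans (length-++ u₁) (cong₂ _+_ (length-take (toℕ i) u) (length-drop (toℕ j) u))))
      (≤-<-trans (+-monoˡ-≤ _ (m⊓n≤m (toℕ i) (length u)))
      (<-≤-trans (+-monoˡ-< _ i<j) (≤-reflexive (m+[n∸m]≡n j≤|u|))))

  accessible? : Dec (Accessible 𝒜)
  accessible? = all? λ p →
    map′ (λ (u , _ , eq) → u , eq)
         (λ (u , eq) → let v , |v|≤n , v≡u = shorten start u (<-wellFounded _)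
                       in v , |v|≤n , trans v≡u eq)
         (reach≤? n start p)

------------------------------------------------------------------------
-- The finite set of accessible automata, listed without repetition

vectors : ∀ {A : Set} → List A → ∀ m → List (Vec A m)
vectors xs zero    = [] ∷ []
vectors xs (suc m) = cartesianProductWith _∷_ xs (vectors xs m)

automata : ∀ k n → List (Automaton k n)
automata k n =
  cartesianProductWith (λ δ (q₀ , F) → automaton δ q₀ F)
    (vectors (vectors (allFin n) k) n)
    (cartesianProductWith _,_ (allFin n) (vectors (inside ∷ outside ∷ []) n))

accessibleAutomata : ∀ k n → List (Automaton k n)
accessibleAutomata k n = filter accessible? (automata k n)

vectors-complete : ∀ {A : Set} {xs : List A} → (∀ x → x ∈ xs) → ∀ {m} (v : Vec A m) → v ∈ vectors xs m
vectors-complete all []      = here refl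
vectors-complete all (x ∷ v) = ∈-cartesianProductWith⁺ _∷_ (all x) (vectors-complete all v)

vectors-unique : ∀ {A : Set} {xs : List A} → Unique xs → ∀ m → Unique (vectors xs m)
vectors-unique xs! zero    = [] ∷ []
vectors-unique xs! (suc m) =
  Uniqueₚ.cartesianProductWith⁺ _∷_ (λ { refl → refl , refl }) xs! (vectors-unique xs! m)

accessibleAutomata-complete : ∀ {k n} (𝒜 : Automaton k n) → Accessible 𝒜 → 𝒜 ∈ accessibleAutomata k n
accessibleAutomata-complete (automaton δ q₀ F) = ∈-filter⁺ accessible?
  (∈-cartesianProductWith⁺ (λ δ (q₀ , F) → automaton δ q₀ F)
    (vectors-complete (vectors-complete ∈-allFin) δ)
    (∈-cartesianProductWith⁺ _,_ (∈-allFin q₀)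
      (vectors-complete (λ { true → here refl ; false → there (here refl) }) F)))

accessibleAutomata-sound : ∀ {k n} (𝒜 : Automaton k n) → 𝒜 ∈ accessibleAutomata k n → Accessible 𝒜
accessibleAutomata-sound {k} {n} 𝒜 𝒜∈ = proj₂ (∈-filter⁻ accessible? {xs = automata k n} 𝒜∈)

accessibleAutomata-unique : ∀ k n → Unique (accessibleAutomata k n)
accessibleAutomata-unique k n = Uniqueₚ.filter⁺ accessible?
  (Uniqueₚ.cartesianProductWith⁺ _ (λ { refl → refl , refl })
    (vectors-unique (vectors-unique (Uniqueₚ.allFin⁺ n) k) n)
    (Uniqueₚ.cartesianProductWith⁺ _,_ (λ { refl → refl , refl }) (Uniqueₚ.allFin⁺ n)
      (vectors-unique (((λ ()) ∷ []) ∷ ([] ∷ [])) n)))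

------------------------------------------------------------------------
-- A unit-cost RAM, programmed in a while language
--
-- Memory consists of named arrays of natural numbers.  A scalar register is
-- cell 0 of an array.

Name : Set
Name = ℕ

Store : Set
Store = Name → ℕ → ℕ

_[_,_↦_] : Store → Name → ℕ → ℕ → Store
(σ [ x , i ↦ v ]) y j = if (x ≡ᵇ y) ∧ (i ≡ᵇ j) then v else σ y j

infix  20 _[_]
infixl 9 _⊗_
infixl 8 _⊕_ _⊖_
infix  7 _≐_ _≺_

data Exp : Set where
  lit             : ℕ → Exp
  _[_]            : Name → Exp → Exp
  _⊕_ _⊖_ _⊗_     : Exp → Exp → Exp
  _≐_ _≺_         : Exp → Exp → Exp

bit : Bool → ℕ
bit b = if b then 1 else 0

⟦_⟧ : Exp → Store → ℕ
⟦ lit c ⟧   σ = c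
⟦ x [ e ] ⟧ σ = σ x (⟦ e ⟧ σ)
⟦ e ⊕ f ⟧   σ = ⟦ e ⟧ σ + ⟦ f ⟧ σ
⟦ e ⊖ f ⟧   σ = ⟦ e ⟧ σ ∸ ⟦ f ⟧ σ
⟦ e ⊗ f ⟧   σ = ⟦ e ⟧ σ * ⟦ f ⟧ σ
⟦ e ≐ f ⟧   σ = bit (⟦ e ⟧ σ ≡ᵇ ⟦ f ⟧ σ)
⟦ e ≺ f ⟧   σ = bit (⟦ e ⟧ σ <ᵇ ⟦ f ⟧ σ)

-- Loading a constant, reading a cell, and each arithmetic operation or
-- comparison take one step.
cost : Exp → ℕ
cost (lit _)   = 1
cost (_ [ e ]) = 1 + cost e
cost (e ⊕ f)   = 1 + cost e + cost f
cost (e ⊖ f)   = 1 + cost e + cost f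
cost (e ⊗ f)   = 1 + cost e + cost f
cost (e ≐ f)   = 1 + cost e + cost f
cost (e ≺ f)   = 1 + cost e + cost f

infix  5 _[_]≔_ _≔_
infixr 4 _⨟_
infix  4 if_then_else′_ while_loop_ for_upTo_loop_

data Stmt : Set where
  skip            : Stmt
  _[_]≔_          : Name → Exp → Exp → Stmt
  _⨟_             : Stmt → Stmt → Stmt
  if_then_else′_  : Exp → Stmt → Stmt → Stmt
  while_loop_       : Exp → Stmt → Stmt

-- σ ⊢ s ⇓ t ⊣ τ: started on σ, the program s halts after t steps with
-- memory τ.  Tests treat 0 as false and everything else as true; writing a
-- cell and branching on a computed value take one step each.
infix 3 _⊢_⇓_⊣_

data _⊢_⇓_⊣_ (σ : Store) : Stmt → ℕ → Store → Set where
  skip   : σ ⊢ skip ⇓ 0 ⊣ σ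
  assign : ∀ {x i e} →
           σ ⊢ x [ i ]≔ e ⇓ 1 + cost i + cost e ⊣ σ [ x , ⟦ i ⟧ σ ↦ ⟦ e ⟧ σ ]
  seq    : ∀ {r s t u ρ τ} → σ ⊢ r ⇓ t ⊣ ρ → ρ ⊢ s ⇓ u ⊣ τ →
           σ ⊢ r ⨟ s ⇓ t + u ⊣ τ
  ifTrue  : ∀ {e r s t τ} → ⟦ e ⟧ σ ≢ 0 → σ ⊢ r ⇓ t ⊣ τ →
            σ ⊢ if e then r else′ s ⇓ 1 + cost e + t ⊣ τ
  ifFalse : ∀ {e r s t τ} → ⟦ e ⟧ σ ≡ 0 → σ ⊢ s ⇓ t ⊣ τ →
            σ ⊢ if e then r else′ s ⇓ 1 + cost e + t ⊣ τ
  whileTrue  : ∀ {e s t u ρ τ} → ⟦ e ⟧ σ ≢ 0 → σ ⊢ s ⇓ t ⊣ ρ → ρ ⊢ while e loop s ⇓ u ⊣ τ →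
               σ ⊢ while e loop s ⇓ 1 + cost e + t + u ⊣ τ
  whileFalse : ∀ {e s} → ⟦ e ⟧ σ ≡ 0 →
               σ ⊢ while e loop s ⇓ 1 + cost e ⊣ σ

deterministic : ∀ {σ s t u τ ρ} → σ ⊢ s ⇓ t ⊣ τ → σ ⊢ s ⇓ u ⊣ ρ → t ≡ u × τ ≡ ρ
deterministic skip              skip              = refl , refl
deterministic assign            assign            = refl , refl
deterministic (seq a b)         (seq c d)         with refl , refl ← deterministic a c
                                                  with refl , refl ← deterministic b d = refl , refl
deterministic (ifTrue _ a)      (ifTrue _ b)      with refl , refl ← deterministic a b = refl , refl
deterministic (ifTrue ≢0 _)     (ifFalse ≡0 _)    = contradiction ≡0 ≢0
deterministic (ifFalse ≡0 _)    (ifTrue ≢0 _)     = contradiction ≡0 ≢0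
deterministic (ifFalse _ a)     (ifFalse _ b)     with refl , refl ← deterministic a b = refl , refl
deterministic (whileTrue _ a b) (whileTrue _ c d) with refl , refl ← deterministic a c
                                                  with refl , refl ← deterministic b d = refl , refl
deterministic (whileTrue ≢0 _ _) (whileFalse ≡0)  = contradiction ≡0 ≢0
deterministic (whileFalse ≡0)   (whileTrue ≢0 _ _) = contradiction ≡0 ≢0
deterministic (whileFalse _)    (whileFalse _)    = refl , refl

infix 21 !_

!_ : Name → Exp
! x = x [ lit 0 ]

_≔_ : Name → Exp → Stmt
x ≔ e = x [ lit 0 ]≔ e

for_upTo_loop_ : Name → Exp → Stmt → Stmt
for x upTo e loop s = x ≔ lit 0 ⨟ while ! x ≺ e loop (s ⨟ x ≔ ! x ⊕ lit 1)

------------------------------------------------------------------------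
-- Moore's algorithm

module Moore where

  -- Input: the automaton.  The transition p · a is stored in next at
  -- position p * k + a, and isFinal is the indicator of the final states.
  pattern states  = 0
  pattern letters = 1
  pattern next    = 2
  pattern initial = 3
  pattern isFinal = 4

  -- Output: the quotient automaton, in the same format.
  outStates outTrans outInitial outFinal : Name
  outStates  = 5
  outTrans   = 6
  outInitial = 7
  outFinal   = 8

  -- Working memory.  π and π′ hold the labels of the two current partitions;
  -- the (k+1)-tuple of the state p occupies positions p * (k+1), …, p * (k+1) + k
  -- of tuple; order is the list of states being sorted.
  π π′ tuple order : Name
  π     = 9
  π′    = 10
  tuple = 11
  order = 12

  bucket sorted forth back : Name
  bucket = 13
  sorted = 14
  forth  = 15
  back   = 16

  p a c i d digit count tmp label fresh differ : Name
  p      = 17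
  a      = 18
  c      = 19
  i      = 20
  d      = 21
  digit  = 22
  count  = 23
  tmp    = 24
  label  = 25
  fresh  = 26
  differ = 27

  n k : Exp
  n = ! states
  k = ! letters

  component : Exp → Exp → Exp
  component q j = tuple [ q ⊗ (k ⊕ lit 1) ⊕ j ]

  oneState : ℕ → Stmt
  oneState b =
    outStates ≔ lit 1 ⨟
    outInitial ≔ lit 0 ⨟
    (for a upTo k loop (outTrans [ ! a ]≔ lit 0)) ⨟
    outFinal ≔ lit b

  computeTuples : Stmt
  computeTuples =
    for p upTo n loop (
      tuple [ ! p ⊗ (k ⊕ lit 1) ]≔ π [ ! p ] ⨟
      (for a upTo k loop
        (tuple [ ! p ⊗ (k ⊕ lit 1) ⊕ (! a ⊕ lit 1) ]≔ π [ next [ ! p ⊗ k ⊕ ! a ] ])))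

  -- One pass of the radix sort: stably sort order by the component number
  -- digit, where bucket [ x ] is the next free position for the value x.
  -- All labels are smaller than n.
  bucketSort : Stmt
  bucketSort =
    (for c upTo n loop (bucket [ ! c ]≔ lit 0)) ⨟
    (for p upTo n loop
      (bucket [ component (! p) (! digit) ]≔ bucket [ component (! p) (! digit) ] ⊕ lit 1)) ⨟
    count ≔ lit 0 ⨟
    (for c upTo n loop (
      tmp ≔ bucket [ ! c ] ⨟
      bucket [ ! c ]≔ ! count ⨟
      count ≔ ! count ⊕ ! tmp)) ⨟
    (for i upTo n loop (
      p ≔ order [ ! i ] ⨟
      c ≔ component (! p) (! digit) ⨟
      sorted [ bucket [ ! c ] ]≔ ! p ⨟
      bucket [ ! c ]≔ bucket [ ! c ] ⊕ lit 1)) ⨟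
    (for i upTo n loop (order [ ! i ]≔ sorted [ ! i ]))

  radixSort : Stmt
  radixSort =
    (for i upTo n loop (order [ ! i ]≔ ! i)) ⨟
    (for d upTo k ⊕ lit 1 loop (digit ≔ k ⊖ ! d ⨟ bucketSort))

  -- Each state gets the label of its predecessor in the sorted order if their
  -- tuples agree, and the next integer otherwise.  For i = 0 the truncated
  -- subtraction makes the first state its own predecessor, hence label 0.
  relabel : Stmt
  relabel =
    label ≔ lit 0 ⨟
    (for i upTo n loop (
      fresh ≔ lit 0 ⨟
      (for d upTo k ⊕ lit 1 loop
        (if component (order [ ! i ]) (! d) ≐ component (order [ ! i ⊖ lit 1 ]) (! d)
         then skip
         else′ (fresh ≔ lit 1))) ⨟
      label ≔ ! label ⊕ ! fresh ⨟
      π′ [ order [ ! i ] ]≔ ! label))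

  -- π and π′ are the same partition iff the labels of each determine those of
  -- the other.
  comparePartitions : Stmt
  comparePartitions =
    (for p upTo n loop (
      forth [ π [ ! p ] ]≔ π′ [ ! p ] ⨟
      back [ π′ [ ! p ] ]≔ π [ ! p ])) ⨟
    differ ≔ lit 0 ⨟
    (for p upTo n loop (
      (if forth [ π [ ! p ] ] ≐ π′ [ ! p ] then skip else′ (differ ≔ lit 1)) ⨟
      (if back [ π′ [ ! p ] ] ≐ π [ ! p ] then skip else′ (differ ≔ lit 1))))

  -- differ starts at 1 since π is undefined before the first iteration.
  mainLoop : Stmt
  mainLoop =
    differ ≔ lit 1 ⨟
    (while ! differ loop (
      (for p upTo n loop (π [ ! p ]≔ π′ [ ! p ])) ⨟
      computeTuples ⨟
      radixSort ⨟
      relabel ⨟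
      comparePartitions))

  -- After the main loop label + 1 is the number of classes.
  quotient : Stmt
  quotient =
    outStates ≔ ! label ⊕ lit 1 ⨟
    outInitial ≔ π [ ! initial ] ⨟
    (for p upTo n loop (
      outFinal [ π [ ! p ] ]≔ isFinal [ ! p ] ⨟
      (for a upTo k loop
        (outTrans [ π [ ! p ] ⊗ k ⊕ ! a ]≔ π [ next [ ! p ⊗ k ⊕ ! a ] ]))))

  moore : Stmt
  moore =
    count ≔ lit 0 ⨟
    (for p upTo n loop (count ≔ ! count ⊕ isFinal [ ! p ])) ⨟
    (if ! count ≐ lit 0 then oneState 0 else′
     (if ! count ≐ n then oneState 1 else′ (
       (for p upTo n loop (π′ [ ! p ]≔ isFinal [ ! p ])) ⨟
       mainLoop ⨟
       quotient)))

  cells : List ℕ → ℕ → ℕ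
  cells []       _       = 0
  cells (x ∷ xs) zero    = x
  cells (x ∷ xs) (suc i) = cells xs i

  load : ∀ {k n} → Automaton k n → Store
  load {k} {n} (automaton δ q₀ F) = memory
    where
    memory : Store
    memory states  = cells (n ∷ [])
    memory letters = cells (k ∷ [])
    memory next    = cells (Vec.toList (Vec.map toℕ (Vec.concat δ)))
    memory initial = cells (toℕ q₀ ∷ [])
    memory isFinal = cells (Vec.toList (Vec.map bit F))
    memory _       = cells []

-- 𝒲 is the running time of Moore's algorithm over k letters: the program
-- halts on every automaton 𝒜 after exactly 𝒲 n 𝒜 steps.  By determinism there
-- is at most one such 𝒲.
IsMooreRunningTime : ∀ {k} → (∀ n → Automaton k n → ℕ) → Set
IsMooreRunningTime {k} 𝒲 =
  ∀ n (𝒜 : Automaton k n) → ∃[ τ ] Moore.load 𝒜 ⊢ Moore.moore ⇓ 𝒲 n 𝒜 ⊣ τ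

------------------------------------------------------------------------
-- Averages and asymptotics

-- The average over the empty list is a junk value.
average : ∀ {A : Set} → (A → ℕ) → List A → ℚ
average f []          = 0ℚ
average f xs@(_ ∷ _) = + sum (map f xs) ℚ./ length xs

infix 4 _=O_

_=O_ : (ℕ → ℚ) → (ℕ → ℕ) → Set
f =O g = ∃[ C ] ∃[ N ] (∀ n → N ≤ n → ℚ.∣ f n ∣ ℚ.≤ + (C * g n) ℚ./ 1)

{-# OPTIONS --safe #-}

-- If p and q are equivalent after l rounds but not after l + 1 under some F₀,
-- a word of length l + 1 separating them runs through l + 1 pairs of states, and
-- flipping F on successively coarser classes of F₀ shows that the constraints
-- "F agrees on the i-th pair" are independent.  So at most 2ⁿ / 2^(l + 1) choices
-- of F leave p and q equivalent after l rounds, and at most n² 2ⁿ / 2^(l + 1)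
-- choices need more than l rounds.  With l = 3 log n + O(1) the latter contribute
-- O(1) rounds to the average, since n rounds always suffice.  Accessibility does
-- not depend on F, so averaging over F for given transitions is enough.  A round
-- takes O(n) steps.

module Submission where

open import Defs
open import Data.Bool.Base using (Bool; true; false; not; _∧_; _xor_; if_then_else_; T)
open import Data.Bool.Properties as Boolₚ using (xor-same; T-∧)
open import Data.Fin.Base using (Fin; zero; suc; toℕ; fromℕ<; combine)
open import Data.Fin.Properties using (any?; all?; ¬∀⟶∃¬; toℕ<n; toℕ-fromℕ<; toℕ-combine)
open import Data.Fin.Subset using (inside; outside)
open import Data.Integer.Base as ℤ using (+≤+)
import Data.Integer.Properties as ℤₚ
open import Data.List.Base using (List; []; _∷_; _++_; length; map; filter; allFin; cartesianProductWith)
open import Data.List.Properties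
  using (map-++; map-∘; filter-++; filter-all; filter-none; length-++; length-map; ++-identityʳ)
open import Data.List.Relation.Unary.All as All using ()
import Data.List.Relation.Unary.All.Properties as Allₚ
open import Data.Nat.Base
open import Data.Nat.DivMod
  using (_/_; _%_; [m+kn]%n≡m%n; m<n⇒m%n≡m; m*n/n≡m; m<n⇒m/n≡0; +-distrib-/-∣ˡ)
open import Data.Nat.Divisibility using (n∣m*n)
open import Data.Nat.ListAction using (sum)
open import Data.Nat.ListAction.Properties using (sum-++)
open import Data.Nat.Logarithm using (⌊log₂_⌋; ⌊log₂⌋-mono-≤; ⌊log₂[2^n]⌋≡n)
open import Data.Nat.Properties
open import Data.Nat.Tactic.RingSolver using (solve-∀)
open import Data.Product.Base using (Σ-syntax; ∃-syntax; _×_; _,_; proj₁; proj₂)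
import Data.Rational.Base as ℚ
import Data.Rational.Properties as ℚₚ
import Data.Rational.Unnormalised.Base as ℚᵘ
import Data.Rational.Unnormalised.Properties as ℚᵘₚ
open import Data.Sum.Base using (_⊎_; inj₁; inj₂)
open import Data.Unit.Base using (⊤; tt)
open import Data.Vec.Base as Vec using (Vec; []; _∷_; lookup; replicate; tabulate; zipWith)
open import Data.Vec.Properties using (lookup-zipWith; lookup∘tabulate; lookup-map; lookup-++ˡ; lookup-++ʳ)
open import Function.Base using (_∘_; const)
open import Function.Bundles using (Equivalence)
open import Relation.Binary.Definitions using (tri<; tri≈; tri>)
open import Relation.Binary.PropositionalEquality hiding ([_])
open import Relation.Nullary.Decidable using (Dec; yes; no; does; _×-dec_; ¬?; dec-true; dec-false)
open import Relation.Nullary.Negation using (¬_; contradiction)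

-- The separating word and the pairs along it are taken from one fixed `F₀`, yet they constrain
-- every `F` that leaves p and q equivalent after l rounds: such an `F` agrees on the pair reached
-- by each prefix of length at most l. How separating words vary with `F` is therefore irrelevant.
-- In 3 log n, two factors n pay for the choice of the pair and the third for the n rounds charged
-- to each exceptional `F`. That n rounds suffice comes from the same count at l = n, without
-- counting classes. For the program, time and correctness cannot be separated: the main loop stops
-- according to the labels it has computed, so sorting and relabelling must be shown to produce
-- exactly the next equivalence. Every other loop has n, K or K + 1 iterations, which is why a bound
-- read off the program text is enough for them.

-- Sums and cardinalities over the subsets of a finite set

∑ : ∀ {n} → (Vec Bool n → ℕ) → ℕ
∑ {zero}  f = f []
∑ {suc n} f = ∑ (f ∘ (true ∷_)) + ∑ (f ∘ (false ∷_))

∑-mono : ∀ {n} {f g : Vec Bool n → ℕ} → (∀ F → f F ≤ g F) → ∑ f ≤ ∑ g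
∑-mono {zero}  f≤g = f≤g []
∑-mono {suc n} f≤g = +-mono-≤ (∑-mono (f≤g ∘ (true ∷_))) (∑-mono (f≤g ∘ (false ∷_)))

∑-cong : ∀ {n} {f g : Vec Bool n → ℕ} → f ≗ g → ∑ f ≡ ∑ g
∑-cong f≗g = ≤-antisym (∑-mono (≤-reflexive ∘ f≗g)) (∑-mono (≤-reflexive ∘ sym ∘ f≗g))

∑-+ : ∀ {n} (f g : Vec Bool n → ℕ) → ∑ (λ F → f F + g F) ≡ ∑ f + ∑ g
∑-+ {zero}  f g = refl
∑-+ {suc n} f g = trans
  (cong₂ _+_ (∑-+ (f ∘ (true ∷_)) (g ∘ (true ∷_))) (∑-+ (f ∘ (false ∷_)) (g ∘ (false ∷_))))
  (interchange (∑ (f ∘ (true ∷_))) (∑ (g ∘ (true ∷_))) (∑ (f ∘ (false ∷_))) (∑ (g ∘ (false ∷_))))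
  where
  interchange : ∀ a b c d → (a + b) + (c + d) ≡ (a + c) + (b + d)
  interchange = solve-∀

∑-*ˡ : ∀ {n} c (f : Vec Bool n → ℕ) → ∑ (λ F → c * f F) ≡ c * ∑ f
∑-*ˡ {zero}  c f = refl
∑-*ˡ {suc n} c f = trans
  (cong₂ _+_ (∑-*ˡ c (f ∘ (true ∷_))) (∑-*ˡ c (f ∘ (false ∷_))))
  (sym (*-distribˡ-+ c (∑ (f ∘ (true ∷_))) (∑ (f ∘ (false ∷_)))))

∑-const : ∀ n c → ∑ {n} (const c) ≡ c * 2 ^ n
∑-const zero    c = sym (*-identityʳ c)
∑-const (suc n) c = trans (cong₂ _+_ (∑-const n c) (∑-const n c)) (double c (2 ^ n))
  where
  double : ∀ c x → c * x + c * x ≡ c * (2 * x)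
  double = solve-∀

infixl 6 _⊻_

_⊻_ : ∀ {n} → Vec Bool n → Vec Bool n → Vec Bool n
_⊻_ = zipWith _xor_

-- Translation by `χ` permutes the vectors: a true entry swaps the two halves of the sum, a false
-- one keeps them.
∑-⊻ : ∀ {n} (f : Vec Bool n → ℕ) χ → ∑ (λ F → f (F ⊻ χ)) ≡ ∑ f
∑-⊻ f []          = refl
∑-⊻ f (true ∷ χ)  = trans (cong₂ _+_ (∑-⊻ (f ∘ (false ∷_)) χ) (∑-⊻ (f ∘ (true ∷_)) χ))
  (+-comm (∑ (f ∘ (false ∷_))) (∑ (f ∘ (true ∷_))))
∑-⊻ f (false ∷ χ) = cong₂ _+_ (∑-⊻ (f ∘ (true ∷_)) χ) (∑-⊻ (f ∘ (false ∷_)) χ)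

card : ∀ {n} → (Vec Bool n → Bool) → ℕ
card S = ∑ (bit ∘ S)

infix 4 _⊆ᵇ_

_⊆ᵇ_ : ∀ {A : Set} → (A → Bool) → (A → Set) → Set
U ⊆ᵇ P = ∀ F → U F ≡ true → P F

bit-mono : ∀ {b c} → (b ≡ true → c ≡ true) → bit b ≤ bit c
bit-mono {false} _   = z≤n
bit-mono {true}  b⇒c rewrite b⇒c refl = ≤-refl

card-mono : ∀ {n} {U S : Vec Bool n → Bool} → U ⊆ᵇ (λ F → S F ≡ true) → card U ≤ card S
card-mono U⊆S = ∑-mono λ F → bit-mono (U⊆S F)

card-split : ∀ {n} (S b : Vec Bool n → Bool) →
             card S ≡ card (λ F → S F ∧ b F) + card (λ F → S F ∧ not (b F))
card-split S b = trans (∑-cong λ F → split (S F) (b F))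
  (∑-+ (λ F → bit (S F ∧ b F)) (λ F → bit (S F ∧ not (b F))))
  where
  split : ∀ s t → bit s ≡ bit (s ∧ t) + bit (s ∧ not t)
  split false _     = refl
  split true  false = refl
  split true  true  = refl

card-empty⊎inhabited : ∀ {n} (U : Vec Bool n → Bool) → card U ≡ 0 ⊎ (∃[ F ] U F ≡ true)
card-empty⊎inhabited {zero} U with U [] in eq
... | true  = inj₂ ([] , eq)
... | false = inj₁ refl
card-empty⊎inhabited {suc n} U
  with card-empty⊎inhabited (U ∘ (true ∷_)) | card-empty⊎inhabited (U ∘ (false ∷_))
... | inj₂ (F , F∈U) | _              = inj₂ (true ∷ F , F∈U)
... | inj₁ _         | inj₂ (F , F∈U) = inj₂ (false ∷ F , F∈U)
... | inj₁ ≡0        | inj₁ ≡0′       = inj₁ (cong₂ _+_ ≡0 ≡0′)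

card-inhabited : ∀ {n} (U : Vec Bool n → Bool) F → U F ≡ true → 1 ≤ card U
card-inhabited U []          F∈U rewrite F∈U = ≤-refl
card-inhabited U (true ∷ F)  F∈U = ≤-trans (card-inhabited (U ∘ (true ∷_)) F F∈U) (m≤m+n _ _)
card-inhabited U (false ∷ F) F∈U = ≤-trans (card-inhabited (U ∘ (false ∷_)) F F∈U) (m≤n+m _ _)

∧-true : ∀ {b c} → b ∧ c ≡ true → b ≡ true × c ≡ true
∧-true {true} c≡ = refl , c≡

does-true : ∀ {P : Set} (P? : Dec P) → does P? ≡ true → P
does-true (yes p) _ = p

not-does-true : ∀ {P : Set} (P? : Dec P) → not (does P?) ≡ true → ¬ P
not-does-true (no ¬p) _ = ¬p

-- A union bound. Hypothesis and conclusion both speak of arbitrary decidable subsets: the pieces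
-- cut from `U` then satisfy the hypothesis, and the bound can be nested, once for p and once for q.
card-union : ∀ {n m c d} {P : Fin m → Vec Bool n → Set} (P? : ∀ i F → Dec (P i F)) →
             (∀ i V → V ⊆ᵇ P i → card V * c ≤ d) →
             ∀ U → U ⊆ᵇ (λ F → ∃[ i ] P i F) → card U * c ≤ m * d
card-union {m = zero} P? small U U⊆∅ with card-empty⊎inhabited U
... | inj₁ ≡0 rewrite ≡0 = z≤n
... | inj₂ (F , F∈U) with () ← proj₁ (U⊆∅ F F∈U)
card-union {m = suc m} {c} {d} {P} P? small U U⊆∪ = begin
  card U * c                ≡⟨ cong (_* c) (card-split U (does ∘ P? zero)) ⟩
  (card U₀ + card U₁) * c   ≡⟨ *-distribʳ-+ c (card U₀) (card U₁) ⟩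
  card U₀ * c + card U₁ * c ≤⟨ +-mono-≤
    (small zero U₀ λ F F∈ → does-true (P? zero F) (proj₂ (∧-true {U F} F∈)))
    (card-union (P? ∘ suc) (small ∘ suc) U₁ U₁⊆) ⟩
  d + m * d                 ∎
  where
  open ≤-Reasoning
  U₀ = λ F → U F ∧ does (P? zero F)
  U₁ = λ F → U F ∧ not (does (P? zero F))
  U₁⊆ : U₁ ⊆ᵇ (λ F → ∃[ i ] P (suc i) F)
  U₁⊆ F F∈ with F∈U , F∉ ← ∧-true {U F} F∈ with U⊆∪ F F∈U
  ... | zero  , F∈P = contradiction F∈P (not-does-true (P? zero F) F∉)
  ... | suc i , F∈P = i , F∈P

-- Moore equivalences under a varying set of final states

module MooreEquivalence {k n : ℕ} (step : Fin n → Fin k → Fin n) where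

  -- Equivalence of level `t`: no word of length at most `t` separates the two states. The
  -- transitions are fixed and `F` is an argument, since the count runs over `F`.
  E : Vec Bool n → ℕ → Fin n → Fin n → Set
  E F zero    p q = lookup F p ≡ lookup F q
  E F (suc t) p q = E F t p q × (∀ a → E F t (step p a) (step q a))

  Stable : Vec Bool n → ℕ → Set
  Stable F t = ∀ p q → E F t p q → E F (suc t) p q

  E? : ∀ F t p q → Dec (E F t p q)
  E? F zero    p q = lookup F p Boolₚ.≟ lookup F q
  E? F (suc t) p q = E? F t p q ×-dec all? (λ a → E? F t (step p a) (step q a))

  E-refl : ∀ F t p → E F t p p
  E-refl F zero    p = refl
  E-refl F (suc t) p = E-refl F t p , λ a → E-refl F t (step p a)

  E-sym : ∀ F t {p q} → E F t p q → E F t q p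
  E-sym F zero    eq       = sym eq
  E-sym F (suc t) (e , es) = E-sym F t e , λ a → E-sym F t (es a)

  E-trans : ∀ F t {p q r} → E F t p q → E F t q r → E F t p r
  E-trans F zero    eq       eq′      = trans eq eq′
  E-trans F (suc t) (e , es) (f , fs) = E-trans F t e f , λ a → E-trans F t (es a) (fs a)

  E-base : ∀ F t {p q} → E F t p q → lookup F p ≡ lookup F q
  E-base F zero    e = e
  E-base F (suc t) e = E-base F t (proj₁ e)

  Splits : ℕ → Fin n → Fin n → Vec Bool n → Set
  Splits t p q F = E F t p q × ¬ E F (suc t) p q

  Splits? : ∀ t p q F → Dec (Splits t p q F)
  Splits? t p q F = E? F t p q ×-dec ¬? (E? F (suc t) p q)

  stable⊎splits : ∀ F t → Stable F t ⊎ (∃[ p ] ∃[ q ] Splits t p q F)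
  stable⊎splits F t with any? (λ p → any? (λ q → Splits? t p q F))
  ... | yes splits = inj₂ splits
  ... | no  ¬split = inj₁ st
    where
    st : Stable F t
    st p q e with E? F (suc t) p q
    ... | yes e′ = e′
    ... | no ¬e′ = contradiction (p , q , e , ¬e′) ¬split

  -- These `χ` are the unions of classes of level `t`; they form a group under `_⊻_`.
  Respects : Vec Bool n → ℕ → Vec Bool n → Set
  Respects F t χ = ∀ r s → E F t r s → lookup χ r ≡ lookup χ s

  class : Vec Bool n → ℕ → Fin n → Vec Bool n
  class F t p = tabulate λ r → does (E? F t p r)

  class-respects : ∀ F t p → Respects F t (class F t p)
  class-respects F t p r s e
    rewrite lookup∘tabulate (λ r → does (E? F t p r)) r
          | lookup∘tabulate (λ r → does (E? F t p r)) s
    with E? F t p r | E? F t p s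
  ... | yes _ | yes _ = refl
  ... | yes f | no ¬g = contradiction (E-trans F t f e) ¬g
  ... | no ¬f | yes g = contradiction (E-trans F t g (E-sym F t e)) ¬f
  ... | no  _ | no  _ = refl

  -- `S` is a union of cosets of the group of unions of classes of `F₀` at level `t`.
  Closed : (Vec Bool n → Bool) → Vec Bool n → ℕ → Set
  Closed S F₀ t = ∀ χ → Respects F₀ t χ → ∀ F → S (F ⊻ χ) ≡ S F

  agree : Fin n → Fin n → Vec Bool n → Bool
  agree p q F = not (lookup F p xor lookup F q)

  agree-true : ∀ p q F → lookup F p ≡ lookup F q → agree p q F ≡ true
  agree-true p q F eq rewrite eq | xor-same (lookup F q) = refl

  agree-⊻ : ∀ p q F χ → lookup χ p ≡ lookup χ q → agree p q (F ⊻ χ) ≡ agree p q F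
  agree-⊻ p q F χ eq
    rewrite lookup-zipWith _xor_ p F χ | lookup-zipWith _xor_ q F χ | eq
    with lookup F p | lookup F q | lookup χ q
  ... | false | false | false = refl
  ... | false | false | true  = refl
  ... | false | true  | false = refl
  ... | false | true  | true  = refl
  ... | true  | false | false = refl
  ... | true  | false | true  = refl
  ... | true  | true  | false = refl
  ... | true  | true  | true  = refl

  disagree-⊻ : ∀ p q F χ → lookup χ p ≡ true → lookup χ q ≡ false →
               agree p q (F ⊻ χ) ≡ not (agree p q F)
  disagree-⊻ p q F χ eq₁ eq₂
    rewrite lookup-zipWith _xor_ p F χ | lookup-zipWith _xor_ q F χ | eq₁ | eq₂
    with lookup F p | lookup F q
  ... | false | false = refl
  ... | false | true  = refl
  ... | true  | false = refl
  ... | true  | true  = refl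

  -- Adding the class of p flips the bit at p and not the one at q.
  card-agree : ∀ F₀ t p q S → Closed S F₀ t → ¬ E F₀ t p q →
               card (λ F → S F ∧ agree p q F) * 2 ≡ card S
  card-agree F₀ t p q S closed ¬e = begin
    card (λ F → S F ∧ agree p q F) * 2
      ≡⟨ double (card (λ F → S F ∧ agree p q F)) ⟩
    card (λ F → S F ∧ agree p q F) + card (λ F → S F ∧ agree p q F)
      ≡⟨ cong (card (λ F → S F ∧ agree p q F) +_) (∑-⊻ (λ F → bit (S F ∧ agree p q F)) χ) ⟨
    card (λ F → S F ∧ agree p q F) + card (λ F → S (F ⊻ χ) ∧ agree p q (F ⊻ χ))
      ≡⟨ cong (card (λ F → S F ∧ agree p q F) +_)
           (∑-cong λ F → cong₂ (λ b c → bit (b ∧ c)) (closed χ (class-respects F₀ t p) F) (disagree-⊻ p q F χ χp χq)) ⟩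
    card (λ F → S F ∧ agree p q F) + card (λ F → S F ∧ not (agree p q F))
      ≡⟨ card-split S (agree p q) ⟨
    card S ∎
    where
    open ≡-Reasoning
    χ = class F₀ t p
    χp : lookup χ p ≡ true
    χp = trans (lookup∘tabulate _ p) (dec-true (E? F₀ t p p) (E-refl F₀ t p))
    χq : lookup χ q ≡ false
    χq = trans (lookup∘tabulate _ q) (dec-false (E? F₀ t p q) ¬e)
    double : ∀ x → x * 2 ≡ x + x
    double = solve-∀

  -- `S` collects the constraints imposed so far, and closedness is all that has to be remembered of
  -- them. At level `suc t` the pair lies in different classes of `F₀`, so requiring agreement on it
  -- halves `S`. At level `t` it lies in one class, so a flip by a union of these coarser classes
  -- changes both bits or neither, and the smaller set is closed for the next pair.
  card-equivalent : ∀ F₀ t p q S U → Splits t p q F₀ → Closed S F₀ (suc t) →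
                    U ⊆ᵇ (λ F → S F ≡ true × E F t p q) →
                    card U * 2 ^ suc t ≤ card S
  card-equivalent F₀ zero p q S U (e , ¬e) closed U⊆ = begin
    card U * 2                         ≤⟨ *-monoˡ-≤ 2 (card-mono {U = U} λ F F∈U →
      let F∈S , e = U⊆ F F∈U in cong₂ _∧_ F∈S (agree-true p q F e)) ⟩
    card (λ F → S F ∧ agree p q F) * 2 ≡⟨ card-agree F₀ 1 p q S closed ¬e ⟩
    card S                             ∎
    where open ≤-Reasoning
  card-equivalent F₀ (suc t) p q S U (e , ¬e) closed U⊆
    -- The pair is equivalent one level down, so its separation is due to a letter; the successors
    -- under that letter split one level lower.
    with a , ¬ea ← ¬∀⟶∃¬ k (λ a → E F₀ (suc t) (step p a) (step q a))
                     (λ a → E? F₀ (suc t) (step p a) (step q a)) (λ es → ¬e (e , es)) = begin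
    card U * (2 * 2 ^ suc t)  ≡⟨ regroup (card U) (2 ^ suc t) ⟩
    card U * 2 ^ suc t * 2    ≤⟨ *-monoˡ-≤ 2 (card-equivalent F₀ t (step p a) (step q a) S′ U
                                   (proj₂ e a , ¬ea) closed′ U⊆′) ⟩
    card S′ * 2               ≡⟨ card-agree F₀ (suc (suc t)) p q S closed ¬e ⟩
    card S                    ∎
    where
    open ≤-Reasoning
    S′ = λ F → S F ∧ agree p q F
    regroup : ∀ x y → x * (2 * y) ≡ x * y * 2
    regroup = solve-∀
    closed′ : Closed S′ F₀ (suc t)
    closed′ χ resp F = cong₂ _∧_ (closed χ (λ r s e → resp r s (proj₁ e)) F)
                                 (agree-⊻ p q F χ (resp p q e))
    U⊆′ : U ⊆ᵇ (λ F → S′ F ≡ true × E F t (step p a) (step q a))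
    U⊆′ F F∈U = let F∈S , f = U⊆ F F∈U in
      cong₂ _∧_ F∈S (agree-true p q F (E-base F (suc t) f)) , proj₂ f a

  -- Any member of `U` can serve as `F₀`. The induction starts from the full set, which is closed
  -- under every flip.
  card-splits : ∀ t p q U → U ⊆ᵇ Splits t p q → card U * 2 ^ suc t ≤ 2 ^ n
  card-splits t p q U U⊆ with card-empty⊎inhabited U
  ... | inj₁ ≡0 rewrite ≡0 = z≤n
  ... | inj₂ (F₀ , F₀∈U) = ≤-trans
    (card-equivalent F₀ t p q (const true) U (U⊆ F₀ F₀∈U) (λ _ _ _ → refl) λ F F∈U → refl , proj₁ (U⊆ F F∈U))
    (≤-reflexive (trans (∑-const n 1) (*-identityˡ (2 ^ n))))

  card-unstable : ∀ t U → U ⊆ᵇ (λ F → ¬ Stable F t) → card U * 2 ^ suc t ≤ n * (n * 2 ^ n)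
  card-unstable t U U⊆ = card-union (λ p F → any? λ q → Splits? t p q F)
    (λ p V V⊆ → card-union (Splits? t p) (card-splits t p) V V⊆)
    U (λ F F∈U → unstable F (U⊆ F F∈U))
    where
    unstable : ∀ F → ¬ Stable F t → ∃[ p ] ∃[ q ] Splits t p q F
    unstable F ¬st with stable⊎splits F t
    ... | inj₁ st = contradiction st ¬st
    ... | inj₂ sp = sp

  -- A split at level `n` would leave fewer than one set under which p and q are equivalent at level
  -- `n`, while `F` itself is such a set.
  stable-at-n : ∀ F → Stable F n
  stable-at-n F with stable⊎splits F n
  ... | inj₁ st = st
  ... | inj₂ (p , q , sp) = contradiction (begin-strict
    2 ^ n              <⟨ ^-monoʳ-< 2 (n<1+n 1) (n<1+n n) ⟩
    2 ^ suc n          ≡⟨ *-identityˡ (2 ^ suc n) ⟨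
    1 * 2 ^ suc n      ≤⟨ *-monoˡ-≤ (2 ^ suc n) (card-inhabited U F (dec-true (E? F n p q) (proj₁ sp))) ⟩
    card U * 2 ^ suc n ≤⟨ card-equivalent F n p q (const true) U sp (λ _ _ _ → refl)
                            (λ G G∈U → refl , does-true (E? G n p q) G∈U) ⟩
    card {n} (const true) ≡⟨ trans (∑-const n 1) (*-identityˡ (2 ^ n)) ⟩
    2 ^ n              ∎) (n≮n (2 ^ n))
    where
    open ≤-Reasoning
    U : Vec Bool n → Bool
    U G = does (E? G n p q)

  stable? : ∀ F t → Dec (Stable F t)
  stable? F t with stable⊎splits F t
  ... | inj₁ st                 = yes st
  ... | inj₂ (p , q , e , ¬e) = no λ st → ¬e (st p q e)

  stable : Vec Bool n → ℕ → Bool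
  stable F t = does (stable? F t)

  -- A bound on the number of rounds, equal to t for most F when t is logarithmic.
  rounds : ℕ → Vec Bool n → ℕ
  rounds t F = if stable F t then t else n

  rounds-stable : ∀ t F → Stable F (rounds t F)
  rounds-stable t F with stable? F t
  ... | yes st = st
  ... | no  _  = stable-at-n F

  -- At most n² 2ⁿ / 2^(t + 1) sets are exceptional and each is charged `n` rounds; the hypothesis
  -- on n³ reduces their total to 2ⁿ, that is, one round on average.
  ∑-rounds : ∀ t → n * (n * n) ≤ 2 ^ suc t → ∑ (rounds t) ≤ suc t * 2 ^ n
  ∑-rounds t n³≤ = begin
    ∑ (rounds t)                        ≤⟨ ∑-mono rounds≤ ⟩
    ∑ (λ F → t + n * bit (not (stable F t))) ≡⟨ ∑-+ (const t) (λ F → n * bit (not (stable F t))) ⟩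
    ∑ {n} (const t) + ∑ (λ F → n * bit (not (stable F t)))
      ≡⟨ cong₂ _+_ (∑-const n t) (∑-*ˡ n (λ F → bit (not (stable F t)))) ⟩
    t * 2 ^ n + n * card (λ F → not (stable F t)) ≤⟨ +-monoʳ-≤ (t * 2 ^ n) few ⟩
    t * 2 ^ n + 2 ^ n                   ≡⟨ +-comm (t * 2 ^ n) (2 ^ n) ⟩
    suc t * 2 ^ n                       ∎
    where
    open ≤-Reasoning
    rounds≤ : ∀ F → rounds t F ≤ t + n * bit (not (stable F t))
    rounds≤ F with stable F t
    ... | true  = m≤m+n t (n * 0)
    ... | false = ≤-trans (≤-reflexive (sym (*-identityʳ n))) (m≤n+m (n * 1) t)
    u = card (λ F → not (stable F t))
    assoc₁ : ∀ n u x → n * u * x ≡ n * (u * x)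
    assoc₁ = solve-∀
    assoc₂ : ∀ n x → n * (n * (n * x)) ≡ n * (n * n) * x
    assoc₂ = solve-∀
    few : n * u ≤ 2 ^ n
    few = *-cancelʳ-≤ (n * u) (2 ^ n) (2 ^ suc t) {{m^n≢0 2 (suc t)}} (begin
      n * u * 2 ^ suc t       ≡⟨ assoc₁ n u (2 ^ suc t) ⟩
      n * (u * 2 ^ suc t)     ≤⟨ *-monoʳ-≤ n (card-unstable t (λ F → not (stable F t))
                                   λ F → not-does-true (stable? F t)) ⟩
      n * (n * (n * 2 ^ n))   ≡⟨ assoc₂ n (2 ^ n) ⟩
      n * (n * n) * 2 ^ n     ≤⟨ *-monoˡ-≤ (2 ^ n) n³≤ ⟩
      2 ^ suc t * 2 ^ n       ≡⟨ *-comm (2 ^ suc t) (2 ^ n) ⟩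
      2 ^ n * 2 ^ suc t       ∎)

-- From sums over final sets to lists of accessible automata

subsets : ∀ n → List (Vec Bool n)
subsets n = vectors (inside ∷ outside ∷ []) n

sum-subsets : ∀ n (f : Vec Bool n → ℕ) → sum (map f (subsets n)) ≡ ∑ f
sum-subsets zero    f = +-identityʳ (f _)
sum-subsets (suc n) f
  rewrite ++-identityʳ (map (false Vec.∷_) (subsets n))
        | map-++ f (map (true Vec.∷_) (subsets n)) (map (false Vec.∷_) (subsets n))
        | sum-++ (map f (map (true Vec.∷_) (subsets n))) (map f (map (false Vec.∷_) (subsets n)))
        | sym (map-∘ {g = f} {f = true Vec.∷_} (subsets n))
        | sym (map-∘ {g = f} {f = false Vec.∷_} (subsets n))
  = cong₂ _+_ (sum-subsets n _) (sum-subsets n _)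

length-subsets : ∀ n → length (subsets n) ≡ 2 ^ n
length-subsets n = begin
  length (subsets n)             ≡⟨ sum-const (subsets n) ⟨
  sum (map (const 1) (subsets n)) ≡⟨ sum-subsets n (const 1) ⟩
  ∑ {n} (const 1)                ≡⟨ ∑-const n 1 ⟩
  1 * 2 ^ n                      ≡⟨ *-identityˡ (2 ^ n) ⟩
  2 ^ n                          ∎
  where
  open ≡-Reasoning
  sum-const : ∀ {A : Set} (xs : List A) → sum (map (const 1) xs) ≡ length xs
  sum-const []       = refl
  sum-const (x ∷ xs) = cong suc (sum-const xs)

module _ {k n : ℕ} (W : Automaton k n → ℕ) (B : ℕ) where

  -- "Average at most `B`" without the division: it survives concatenation and holds for a fibre
  -- without accessible automata.
  Bounded : List (Automaton k n) → Set
  Bounded xs = sum (map W (filter accessible? xs)) ≤ B * length (filter accessible? xs)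

  Bounded-++ : ∀ {xs ys} → Bounded xs → Bounded ys → Bounded (xs ++ ys)
  Bounded-++ {xs} {ys} bx by
    rewrite filter-++ accessible? xs ys
          | map-++ W (filter accessible? xs) (filter accessible? ys)
          | sum-++ (map W (filter accessible? xs)) (map W (filter accessible? ys))
          | length-++ (filter accessible? xs) {filter accessible? ys}
          | *-distribˡ-+ B (length (filter accessible? xs)) (length (filter accessible? ys))
    = +-mono-≤ bx by

  -- Accessibility does not depend on the final states, so for given
  -- transitions all choices of F are counted or none.
  Bounded-fibre : ∀ δ q₀ → ∑ (W ∘ automaton δ q₀) ≤ B * 2 ^ n →
                  Bounded (map (automaton δ q₀) (subsets n))
  Bounded-fibre δ q₀ bound with accessible? (automaton δ q₀ (replicate n false))
  ... | no ¬acc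
    rewrite filter-none accessible? {map (automaton δ q₀) (subsets n)}
              (Allₚ.map⁺ (All.universal (λ _ acc → ¬acc acc) (subsets n)))
    = z≤n
  ... | yes acc
    rewrite filter-all accessible? {map (automaton δ q₀) (subsets n)}
              (Allₚ.map⁺ (All.universal (λ _ → acc) (subsets n)))
          | sym (map-∘ {g = W} {f = automaton δ q₀} (subsets n))
          | sum-subsets n (W ∘ automaton δ q₀)
          | length-map (automaton δ q₀) (subsets n)
          | length-subsets n
    = bound

  Bounded-automata : (∀ δ q₀ → ∑ (W ∘ automaton δ q₀) ≤ B * 2 ^ n) → Bounded (automata k n)
  Bounded-automata bound = overδ (vectors (vectors (allFin n) k) n)
    where
    pair : Vec (Vec (Fin n) k) n → Fin n × Vec Bool n → Automaton k n
    pair δ x = automaton δ (proj₁ x) (proj₂ x)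
    overq : ∀ δ qs → Bounded (map (pair δ) (cartesianProductWith _,_ qs (subsets n)))
    overq δ []       = z≤n
    overq δ (q ∷ qs) = subst Bounded
      (sym (trans (map-++ (pair δ) (map (q ,_) (subsets n)) (cartesianProductWith _,_ qs (subsets n)))
                  (cong (_++ map (pair δ) (cartesianProductWith _,_ qs (subsets n)))
                        (sym (map-∘ {g = pair δ} {f = q ,_} (subsets n))))))
      (Bounded-++ {map (automaton δ q) (subsets n)} (Bounded-fibre δ q (bound δ q)) (overq δ qs))
    overδ : ∀ δs → Bounded (cartesianProductWith (λ δ (q₀ , F) → automaton δ q₀ F) δs
                             (cartesianProductWith _,_ (allFin n) (subsets n)))
    overδ []       = z≤n
    overδ (δ ∷ δs) = Bounded-++
      {map (pair δ) (cartesianProductWith _,_ (allFin n) (subsets n))}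
      (overq δ (allFin n)) (overδ δs)

-- Rational averages and the logarithmic bound

-- The fraction is reduced to lowest terms, so the comparison is made between unnormalised
-- representatives, where it is a cross-multiplication.
∣/∣≤ : ∀ a b l .{{_ : NonZero l}} → a ≤ b * l → ℚ.∣ ℤ.+ a ℚ./ l ∣ ℚ.≤ ℤ.+ b ℚ./ 1
∣/∣≤ a b l@(suc l-1) a≤bl = subst (ℚ._≤ ℤ.+ b ℚ./ 1)
  (sym (ℚₚ.0≤p⇒∣p∣≡p (ℚₚ.nonNegative⁻¹ _ {{ℚₚ.normalize-nonNeg a l}})))
  (ℚₚ.toℚᵘ-cancel-≤ (begin
    ℚ.toℚᵘ (ℤ.+ a ℚ./ l)  ≃⟨ ℚₚ.toℚᵘ-fromℚᵘ (ℚᵘ.mkℚᵘ (ℤ.+ a) l-1) ⟩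
    ℚᵘ.mkℚᵘ (ℤ.+ a) l-1  ≤⟨ ℚᵘ.*≤* (subst₂ ℤ._≤_ (ℤₚ.pos-* a 1) (ℤₚ.pos-* b l)
                             (+≤+ (subst (_≤ b * l) (sym (*-identityʳ a)) a≤bl))) ⟩
    ℚᵘ.mkℚᵘ (ℤ.+ b) 0    ≃⟨ ℚₚ.toℚᵘ-fromℚᵘ (ℚᵘ.mkℚᵘ (ℤ.+ b) 0) ⟨
    ℚ.toℚᵘ (ℤ.+ b ℚ./ 1)  ∎))
  where open ℚᵘₚ.≤-Reasoning

average≤ : ∀ {A : Set} (f : A → ℕ) xs B → sum (map f xs) ≤ B * length xs →
           ℚ.∣ average f xs ∣ ℚ.≤ ℤ.+ B ℚ./ 1
average≤ f []         B _     = ∣/∣≤ 0 B 1 z≤n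
average≤ f xs@(_ ∷ _) B sum≤ = ∣/∣≤ (sum (map f xs)) B (length xs) sum≤

n<2^1+⌊log₂n⌋ : ∀ n → n < 2 ^ suc ⌊log₂ n ⌋
n<2^1+⌊log₂n⌋ n with n <? 2 ^ suc ⌊log₂ n ⌋
... | yes n<2^ = n<2^
... | no  n≮2^ = contradiction
  (subst (_≤ ⌊log₂ n ⌋) (⌊log₂[2^n]⌋≡n (suc ⌊log₂ n ⌋)) (⌊log₂⌋-mono-≤ (≮⇒≥ n≮2^)))
  1+n≰n

-- With t = 3⌊log₂ n⌋ + 2 rounds, at most 2ⁿ / n of the F are exceptional.
average-bound : ∀ {k} (W : ∀ n → Automaton k n → ℕ) c →
  (∀ n t δ q₀ F → let open MooreEquivalence (λ p a → lookup (lookup δ p) a) in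
    W n (automaton δ q₀ F) ≤ n * suc (rounds t F) * c) →
  (λ n → average (W n) (accessibleAutomata k n)) =O (λ n → n * ⌊log₂ n ⌋)
-- One more than the averaged rounds gives 1 + (t + 1) = 4 + 3ℓ, which is at most 7ℓ as soon as ℓ ≥
-- 1, hence 7 and the threshold 2.
average-bound {k} W c W≤ = c * 7 , 2 , λ n 2≤n →
  average≤ (W n) (accessibleAutomata k n) (c * 7 * (n * ⌊log₂ n ⌋))
    (Bounded-automata (W n) (c * 7 * (n * ⌊log₂ n ⌋)) (fibre n 2≤n))
  where
  fibre : ∀ n → 2 ≤ n → ∀ δ q₀ → ∑ (W n ∘ automaton δ q₀) ≤ c * 7 * (n * ⌊log₂ n ⌋) * 2 ^ n
  fibre n 2≤n δ q₀ = begin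
    ∑ (W n ∘ automaton δ q₀)                  ≤⟨ ∑-mono (λ F → W≤ n t δ q₀ F) ⟩
    ∑ (λ F → n * suc (rounds t F) * c)        ≡⟨ ∑-cong {n} (λ F → rotate n (suc (rounds t F)) c) ⟩
    ∑ (λ F → c * n * suc (rounds t F))        ≡⟨ ∑-*ˡ (c * n) (suc ∘ rounds t) ⟩
    c * n * ∑ (suc ∘ rounds t)                ≡⟨ cong (c * n *_) (∑-+ (const 1) (rounds t)) ⟩
    c * n * (∑ {n} (const 1) + ∑ (rounds t))  ≤⟨ *-monoʳ-≤ (c * n) (+-mono-≤ (≤-reflexive (∑-const n 1)) (∑-rounds t n³≤)) ⟩
    c * n * (1 * 2 ^ n + suc t * 2 ^ n)       ≡⟨ regroup c n ℓ (2 ^ n) ⟩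
    c * n * (4 + 3 * ℓ) * 2 ^ n               ≤⟨ *-monoˡ-≤ (2 ^ n) (*-monoʳ-≤ (c * n) (+-monoˡ-≤ (3 * ℓ) (m≤m*n 4 ℓ))) ⟩
    c * n * (4 * ℓ + 3 * ℓ) * 2 ^ n           ≡⟨ regroup′ c n ℓ (2 ^ n) ⟩
    c * 7 * (n * ℓ) * 2 ^ n                   ∎
    where
    open ≤-Reasoning
    open MooreEquivalence {k} {n} (λ p a → lookup (lookup δ p) a)
    ℓ = ⌊log₂ n ⌋
    -- The 2 makes `suc t` equal to 3(ℓ + 1), the exponent obtained by cubing n ≤ 2^(ℓ + 1).
    t = 2 + 3 * ℓ
    instance
      ℓ≢0 : NonZero ℓ
      ℓ≢0 = >-nonZero (⌊log₂⌋-mono-≤ 2≤n)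
    n≤ : n ≤ 2 ^ suc ℓ
    n≤ = <⇒≤ (n<2^1+⌊log₂n⌋ n)
    n³≤ : n * (n * n) ≤ 2 ^ suc t
    n³≤ = begin
      n * (n * n)                             ≤⟨ *-mono-≤ n≤ (*-mono-≤ n≤ n≤) ⟩
      2 ^ suc ℓ * (2 ^ suc ℓ * 2 ^ suc ℓ)     ≡⟨ cong (2 ^ suc ℓ *_) (^-distribˡ-+-* 2 (suc ℓ) (suc ℓ)) ⟨
      2 ^ suc ℓ * 2 ^ (suc ℓ + suc ℓ)         ≡⟨ ^-distribˡ-+-* 2 (suc ℓ) (suc ℓ + suc ℓ) ⟨
      2 ^ (suc ℓ + (suc ℓ + suc ℓ))           ≡⟨ cong (2 ^_) (three ℓ) ⟩
      2 ^ suc t                               ∎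
      where
      three : ∀ ℓ → suc ℓ + (suc ℓ + suc ℓ) ≡ suc (2 + 3 * ℓ)
      three = solve-∀
    rotate : ∀ n x c → n * x * c ≡ c * n * x
    rotate = solve-∀
    regroup : ∀ c n ℓ x → c * n * (1 * x + suc (2 + 3 * ℓ) * x) ≡ c * n * (4 + 3 * ℓ) * x
    regroup = solve-∀
    regroup′ : ∀ c n ℓ x → c * n * (4 * ℓ + 3 * ℓ) * x ≡ c * 7 * (n * ℓ) * x
    regroup′ = solve-∀

-- Frames: the memory that a program leaves alone

T-∧⁻ : ∀ {b c} → T (b ∧ c) → T b × T c
T-∧⁻ = Equivalence.to T-∧

unwritten : Name → Stmt → Bool
unwritten y skip                  = true
unwritten y (x [ _ ]≔ _)          = not (x ≡ᵇ y)
unwritten y (r ⨟ s)               = unwritten y r ∧ unwritten y s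
unwritten y (if _ then r else′ s) = unwritten y r ∧ unwritten y s
unwritten y (while _ loop s)      = unwritten y s

-- A record, so that `s` can be inferred from a frame; the bare function type mentions it only under
-- `unwritten`, which unification cannot invert.
record Frame (s : Stmt) (σ τ : Store) : Set where
  constructor mkFrame
  field
    unchanged : ∀ y → T (unwritten y s) → ∀ i → τ y i ≡ σ y i

  -- For a given name the side condition computes to ⊤.
  keep : ∀ y {u : T (unwritten y s)} i → τ y i ≡ σ y i
  keep y {u} = unchanged y u

open Frame

update-frame : ∀ σ x i v y j → T (not (x ≡ᵇ y)) → (σ [ x , i ↦ v ]) y j ≡ σ y j
update-frame σ x i v y j x≢y with x ≡ᵇ y
... | false = refl

frame : ∀ {s σ t τ} → σ ⊢ s ⇓ t ⊣ τ → Frame s σ τ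
frame = mkFrame ∘ go
  where
  go : ∀ {s σ t τ} → σ ⊢ s ⇓ t ⊣ τ → ∀ y → T (unwritten y s) → ∀ i → τ y i ≡ σ y i
  go skip y u i = refl
  go {σ = σ} (assign {x} {e} {f}) y u j = update-frame σ x (⟦ e ⟧ σ) (⟦ f ⟧ σ) y j u
  go (seq a b) y u i = let u₁ , u₂ = T-∧⁻ u in trans (go b y u₂ i) (go a y u₁ i)
  go (ifTrue _ a) y u i = go a y (proj₁ (T-∧⁻ u)) i
  go (ifFalse {r = r} _ a) y u i = go a y (proj₂ (T-∧⁻ {unwritten y r} u)) i
  go (whileTrue _ a b) y u i = trans (go b y u i) (go a y u i)
  go (whileFalse _) y u i = refl

infixr 5 _∙_

_∙_ : ∀ {r s σ ρ τ} → Frame r σ ρ → Frame s ρ τ → Frame (r ⨟ s) σ τ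
_∙_ {r} fr fr′ = mkFrame λ y u i → let u₁ , u₂ = T-∧⁻ {unwritten y r} u in
  trans (unchanged fr′ y u₂ i) (unchanged fr y u₁ i)

fixed : Exp → Stmt → Bool
fixed (lit _)   s = true
fixed (x [ e ]) s = unwritten x s ∧ fixed e s
fixed (e ⊕ f)   s = fixed e s ∧ fixed f s
fixed (e ⊖ f)   s = fixed e s ∧ fixed f s
fixed (e ⊗ f)   s = fixed e s ∧ fixed f s
fixed (e ≐ f)   s = fixed e s ∧ fixed f s
fixed (e ≺ f)   s = fixed e s ∧ fixed f s

fixed-frame : ∀ e {s σ τ} → T (fixed e s) → Frame s σ τ → ⟦ e ⟧ τ ≡ ⟦ e ⟧ σ
fixed-frame (lit _)   fx fr = refl
fixed-frame (x [ e ]) {s} {σ} {τ} fx fr = let u , v = T-∧⁻ fx in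
  trans (unchanged fr x u (⟦ e ⟧ τ)) (cong (σ x) (fixed-frame e v fr))
fixed-frame (e ⊕ f) {s} fx fr = let u , v = T-∧⁻ {fixed e s} fx in cong₂ _+_ (fixed-frame e u fr) (fixed-frame f v fr)
fixed-frame (e ⊖ f) {s} fx fr = let u , v = T-∧⁻ {fixed e s} fx in cong₂ _∸_ (fixed-frame e u fr) (fixed-frame f v fr)
fixed-frame (e ⊗ f) {s} fx fr = let u , v = T-∧⁻ {fixed e s} fx in cong₂ _*_ (fixed-frame e u fr) (fixed-frame f v fr)
fixed-frame (e ≐ f) {s} fx fr = let u , v = T-∧⁻ {fixed e s} fx in
  cong₂ (λ a b → bit (a ≡ᵇ b)) (fixed-frame e u fr) (fixed-frame f v fr)
fixed-frame (e ≺ f) {s} fx fr = let u , v = T-∧⁻ {fixed e s} fx in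
  cong₂ (λ a b → bit (a <ᵇ b)) (fixed-frame e u fr) (fixed-frame f v fr)

-- Tests and timed total-correctness rules

bit-<ᵇ : ∀ {m n} → m < n → bit (m <ᵇ n) ≢ 0
bit-<ᵇ {m} {n} m<n with m <ᵇ n | <⇒<ᵇ m<n
... | true | _ = λ ()

bit-≮ᵇ : ∀ {m n} → ¬ m < n → bit (m <ᵇ n) ≡ 0
bit-≮ᵇ {m} {n} m≮n with m <ᵇ n in eq
... | false = refl
... | true  = contradiction (<ᵇ⇒< m n (subst T (sym eq) tt)) m≮n

bit-≡ᵇ-≢0 : ∀ {m n} → bit (m ≡ᵇ n) ≢ 0 → m ≡ n
bit-≡ᵇ-≢0 {m} {n} ≢0 with m ≡ᵇ n in eq
... | false = contradiction refl ≢0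
... | true  = ≡ᵇ⇒≡ m n (subst T (sym eq) tt)

bit-≡ᵇ-≡0 : ∀ {m n} → bit (m ≡ᵇ n) ≡ 0 → m ≢ n
bit-≡ᵇ-≡0 {m} {n} ≡0 m≡n with m ≡ᵇ n | ≡⇒≡ᵇ m n m≡n
... | true | _ with () ← ≡0

if-same : ∀ {i j v w : ℕ} → i ≡ j → (if i ≡ᵇ j then v else w) ≡ v
if-same {i} {j} i≡j with i ≡ᵇ j | ≡⇒≡ᵇ i j i≡j
... | true | _ = refl

if-other : ∀ {i j v w : ℕ} → i ≢ j → (if i ≡ᵇ j then v else w) ≡ w
if-other {i} {j} i≢j with i ≡ᵇ j in eq
... | false = refl
... | true  = contradiction (≡ᵇ⇒≡ i j (subst T (sym eq) tt)) i≢j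

-- K is the number of letters.  The syntactic bound is to be multiplied by a scale
-- m, which is n for a loop of n iterations and may be 1 for its body: the factor
-- 2 + K covers the tests of such a loop, and all of a loop over K or K + 1.
module _ (K : ℕ) where

  bound : Stmt → ℕ
  bound skip                  = 0
  bound (_ [ i ]≔ e)          = 1 + cost i + cost e
  bound (r ⨟ s)               = bound r + bound s
  bound (if e then r else′ s) = 1 + cost e + (bound r + bound s)
  bound (while e loop s)      = (2 + K) * (1 + cost e + bound s)

  record Run (m : ℕ) (σ : Store) (s : Stmt) (Q : Store → Set) : Set where
    constructor run
    field
      {time}     : ℕ
      {end}      : Store
      derivation : σ ⊢ s ⇓ time ⊣ end
      fast       : time ≤ m * bound s
      post       : Q end

  -- N iterations of a body that is fast on the scale m′ are fast on the scale m.
  Scale : ℕ → ℕ → ℕ → Set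
  Scale m′ N m = suc N * m′ ≤ m * (2 + K)

module _ {K : ℕ} where

  weaken : ∀ {m σ s Q R} → Run K m σ s Q → (∀ τ → Frame s σ τ → Q τ → R τ) → Run K m σ s R
  weaken (run d f q) Q⇒R = run d f (Q⇒R _ (frame d) q)

  skipᵣ : ∀ {m σ Q} → Q σ → Run K m σ skip Q
  skipᵣ q = run skip z≤n q

  assignᵣ : ∀ {m σ x i e Q} .{{_ : NonZero m}} → Q (σ [ x , ⟦ i ⟧ σ ↦ ⟦ e ⟧ σ ]) → Run K m σ (x [ i ]≔ e) Q
  assignᵣ {m} {i = i} {e} q = run assign (m≤n*m (1 + cost i + cost e) m) q

  infixr 2 _then_

  -- The rest of the program knows the intermediate store only through `Q` and the frame, so stores
  -- do not pile up as nested updates.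
  _then_ : ∀ {m σ r s Q R} → Run K m σ r Q → (∀ ρ → Frame r σ ρ → Q ρ → Run K m ρ s R) → Run K m σ (r ⨟ s) R
  _then_ {m} {r = r} {s} (run d f q) next with next _ (frame d) q
  ... | run d′ f′ q′ = run (seq d d′)
    (≤-trans (+-mono-≤ f f′) (≤-reflexive (sym (*-distribˡ-+ m (bound K r) (bound K s))))) q′

  -- Here the updated store stays explicit, so that reading it back computes.
  assign-then : ∀ {m σ x i e s Q} .{{_ : NonZero m}} → Run K m (σ [ x , ⟦ i ⟧ σ ↦ ⟦ e ⟧ σ ]) s Q →
                Run K m σ (x [ i ]≔ e ⨟ s) Q
  assign-then {m} {i = i} {e} {s} (run d f q) = run (seq assign d)
    (≤-trans (+-mono-≤ (m≤n*m (1 + cost i + cost e) m) f)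
             (≤-reflexive (sym (*-distribˡ-+ m (1 + cost i + cost e) (bound K s))))) q

  ifᵣ : ∀ {m σ e r s Q} .{{_ : NonZero m}} → (⟦ e ⟧ σ ≢ 0 → Run K m σ r Q) → (⟦ e ⟧ σ ≡ 0 → Run K m σ s Q) →
        Run K m σ (if e then r else′ s) Q
  ifᵣ {m} {σ} {e} {r} {s} whenTrue whenFalse with ⟦ e ⟧ σ ≟ 0
  ... | no ≢0 with run d f q ← whenTrue ≢0 = run (ifTrue ≢0 d) (begin
    1 + cost e + _                          ≤⟨ +-mono-≤ (m≤n*m (1 + cost e) m) (≤-trans f (*-monoʳ-≤ m (m≤m+n (bound K r) (bound K s)))) ⟩
    m * (1 + cost e) + m * (bound K r + bound K s) ≡⟨ *-distribˡ-+ m (1 + cost e) (bound K r + bound K s) ⟨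
    m * (1 + cost e + (bound K r + bound K s))    ∎) q
    where open ≤-Reasoning
  ... | yes ≡0 with run d f q ← whenFalse ≡0 = run (ifFalse ≡0 d) (begin
    1 + cost e + _                          ≤⟨ +-mono-≤ (m≤n*m (1 + cost e) m) (≤-trans f (*-monoʳ-≤ m (m≤n+m (bound K s) (bound K r)))) ⟩
    m * (1 + cost e) + m * (bound K r + bound K s) ≡⟨ *-distribˡ-+ m (1 + cost e) (bound K r + bound K s) ⟨
    m * (1 + cost e + (bound K r + bound K s))    ∎) q
    where open ≤-Reasoning

  module _ (x : Name) (e : Exp) {s : Stmt} where

    private
      body = s ⨟ x ≔ ! x ⊕ lit 1
      loop = while ! x ≺ e loop body

    -- The body changes neither the counter nor the limit, a check on the text that evaluates away
    -- at each use, so there are exactly `N` iterations. The frame passed to an iteration starts at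
    -- the store before the loop, which carries earlier facts into every iteration.
    forᵣ : ∀ {m σ Q} m′ N (I : ℕ → Store → Set) .{{_ : NonZero m}} .{{_ : NonZero m′}} →
           T (unwritten x s ∧ fixed e body) → Scale K m′ N m → ⟦ e ⟧ σ ≡ N →
           I 0 (σ [ x , 0 ↦ 0 ]) →
           (∀ j ρ → j < N → ρ x 0 ≡ j → Frame (for x upTo e loop s) σ ρ → I j ρ →
              Run K m′ ρ s (λ τ → I (suc j) (τ [ x , 0 ↦ suc j ]))) →
           (∀ τ → Frame (for x upTo e loop s) σ τ → I N τ → Q τ) →
           Run K m σ (for x upTo e loop s) Q
    forᵣ {m} {σ} {Q} m′ N I fx scale e≡N I₀ step after =
      let u , τ , d , f , fr , q = iterate N 0 σ₀ (+-identityʳ N) x≡0 (mkFrame λ y u i → update-frame σ x 0 0 y i (uf y u)) I₀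
      in run (seq assign d) (begin
        3 + u                                            ≤⟨ +-mono-≤ (m≤n*m 3 m) f ⟩
        -- The failing last test is charged as a whole further iteration, hence `suc N` in `Scale`.
        m * 3 + (N * (m′ * (c + B)) + c)                 ≤⟨ +-monoʳ-≤ (m * 3) (+-monoʳ-≤ (N * (m′ * (c + B))) (≤-trans (m≤m+n c B) (m≤n*m (c + B) m′))) ⟩
        m * 3 + (N * (m′ * (c + B)) + m′ * (c + B))      ≡⟨ regroup m N m′ (c + B) ⟩
        m * 3 + suc N * m′ * (c + B)                     ≤⟨ +-monoʳ-≤ (m * 3) (*-monoˡ-≤ (c + B) scale) ⟩
        m * 3 + m * (2 + K) * (c + B)                    ≡⟨ regroup′ m (2 + K) (c + B) ⟩
        m * (3 + (2 + K) * (c + B))                      ∎) q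
      where
      open ≤-Reasoning
      σ₀ = σ [ x , 0 ↦ 0 ]
      c = 1 + cost (! x ≺ e)
      B = bound K body
      unx : T (unwritten x s)
      unx = proj₁ (T-∧⁻ fx)
      fxe : T (fixed e body)
      fxe = proj₂ (T-∧⁻ {unwritten x s} fx)
      uf : ∀ y → T (unwritten y (for x upTo e loop s)) → T (not (x ≡ᵇ y))
      uf y u = proj₁ (T-∧⁻ u)
      ub : ∀ y → T (unwritten y body) → T (unwritten y (for x upTo e loop s))
      ub y u = Equivalence.from T-∧ (proj₂ (T-∧⁻ {unwritten y s} u) , u)
      self : ∀ ρ v → (ρ [ x , 0 ↦ v ]) x 0 ≡ v
      self ρ v with x ≡ᵇ x | ≡⇒≡ᵇ x x refl
      ... | true | _ = refl
      x≡0 : σ₀ x 0 ≡ 0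
      x≡0 = self σ 0
      regroup : ∀ m N m′ B → m * 3 + (N * (m′ * B) + m′ * B) ≡ m * 3 + suc N * m′ * B
      regroup = solve-∀
      regroup′ : ∀ m k B → m * 3 + m * k * B ≡ m * (3 + k * B)
      regroup′ = solve-∀
      e≡ : ∀ {ρ} → Frame (for x upTo e loop s) σ ρ → ⟦ e ⟧ ρ ≡ N
      e≡ fr = trans (fixed-frame e {body} fxe (mkFrame λ y u i → unchanged fr y (ub y u) i)) e≡N
      iterate : ∀ r j ρ → r + j ≡ N → ρ x 0 ≡ j → Frame (for x upTo e loop s) σ ρ → I j ρ →
                Σ[ u ∈ ℕ ] Σ[ τ ∈ Store ] (ρ ⊢ loop ⇓ u ⊣ τ) × u ≤ r * (m′ * (c + B)) + c ×
                Frame (for x upTo e loop s) σ τ × Q τ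
      iterate zero j ρ refl x≡ fr inv =
        c , ρ , whileFalse (bit-≮ᵇ (λ lt → n≮n j (subst₂ _<_ x≡ (e≡ fr) lt))) , ≤-refl , fr , after ρ fr inv
      iterate (suc r) j ρ eq x≡ fr inv
        with step j ρ (≤-trans (s≤s (m≤n+m j r)) (≤-reflexive eq)) x≡ fr inv
      ... | run {t} {τ} d f inv′ with iterate r (suc j) (τ [ x , 0 ↦ suc j ]) (trans (+-suc r j) eq) (self τ (suc j))
               (mkFrame λ y u i → trans (update-frame τ x 0 (suc j) y i (uf y u))
                            (trans (unchanged (frame d) y (proj₁ (T-∧⁻ {unwritten y s} (proj₂ (T-∧⁻ {not (x ≡ᵇ y)} u)))) i) (unchanged fr y u i)))
               inv′
      ... | u , τ′ , d′ , f′ , fr′ , q = _ , τ′ ,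
        whileTrue (bit-<ᵇ (subst₂ _<_ (sym x≡) (sym (e≡ fr)) (≤-trans (s≤s (m≤n+m j r)) (≤-reflexive eq))))
                  -- Incrementing the counter takes 6 steps: one write, one for its index, four for
                  -- the expression.
                  (seq d (subst (λ v → τ ⊢ x ≔ ! x ⊕ lit 1 ⇓ 6 ⊣ τ [ x , 0 ↦ v ])
                               (trans (+-comm (τ x 0) 1) (cong suc (trans (unchanged (frame d) x unx 0) x≡))) assign))
                  d′ ,
        (begin
          c + (t + 6) + u                                            ≤⟨ +-mono-≤ (+-monoʳ-≤ c (+-mono-≤ f (m≤n*m 6 m′))) f′ ⟩
          c + (m′ * bound K s + m′ * 6) + (r * (m′ * (c + B)) + c)       ≤⟨ +-monoˡ-≤ _ (+-monoˡ-≤ _ (m≤n*m c m′)) ⟩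
          m′ * c + (m′ * bound K s + m′ * 6) + (r * (m′ * (c + B)) + c)  ≡⟨ collect m′ c (bound K s) 6 r ⟩
          suc r * (m′ * (c + B)) + c ∎) ,
        fr′ , q
        where
        collect : ∀ m′ c b a r → m′ * c + (m′ * b + m′ * a) + (r * (m′ * (c + (b + a))) + c) ≡ suc r * (m′ * (c + (b + a))) + c
        collect = solve-∀

  -- I r holds before the test if at most r iterations remain.
  whileᵣ : ∀ {m σ e s Q} .{{_ : NonZero m}} r .{{_ : NonZero r}} (I : ℕ → Store → Set) →
           (∀ ρ → I 0 ρ → ⟦ e ⟧ ρ ≡ 0) → (∀ r ρ → I (suc r) ρ → Run K m ρ s (I r)) →
           I r σ → (∀ r τ → I r τ → Q τ) → Run K (m * r) σ (while e loop s) Q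
  whileᵣ {m} {σ} {e} {s} {Q} r I exit step inv after =
    let u , τ , d , fast , q = iterate r σ inv in run d (begin
      u                              ≤⟨ fast ⟩
      r * (m * b) + c                ≤⟨ +-monoʳ-≤ (r * (m * b)) (≤-trans (m≤m+n c (bound K s)) (m≤n*m b (m * r) {{m*n≢0 m r}})) ⟩
      r * (m * b) + m * r * b        ≡⟨ double m r b ⟩
      m * r * (2 * b)                ≤⟨ *-monoʳ-≤ (m * r) (*-monoˡ-≤ b (m≤m+n 2 K)) ⟩
      m * r * ((2 + K) * b)          ∎) q
    where
    open ≤-Reasoning
    c = 1 + cost e
    b = c + bound K s
    double : ∀ m r b → r * (m * b) + m * r * b ≡ m * r * (2 * b)
    double = solve-∀
    iterate : ∀ r σ → I r σ → Σ[ u ∈ ℕ ] Σ[ τ ∈ Store ] (σ ⊢ while e loop s ⇓ u ⊣ τ) × u ≤ r * (m * b) + c × Q τ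
    iterate r σ inv with ⟦ e ⟧ σ ≟ 0
    ... | yes ≡0 = c , σ , whileFalse ≡0 , m≤n+m c _ , after r σ inv
    iterate zero    σ inv | no ≢0 = contradiction (exit σ inv) ≢0
    iterate (suc r) σ inv | no ≢0
      with run {t} {ρ} d fast inv′ ← step r σ inv
      with u , τ , d′ , fast′ , q ← iterate r ρ inv′
      = c + t + u , τ , whileTrue ≢0 d d′ , (begin
        c + t + u                                     ≤⟨ +-mono-≤ (+-mono-≤ (m≤n*m c m) fast) fast′ ⟩
        m * c + m * bound K s + (r * (m * b) + c)     ≡⟨ collect m c (bound K s) r ⟩
        suc r * (m * b) + c                           ∎) , q
      where
      collect : ∀ m c b r → m * c + m * b + (r * (m * (c + b)) + c) ≡ suc r * (m * (c + b)) + c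
      collect = solve-∀

-- Array updates, counting and permutations

-- The two obligations for reading cell `j` after a write to cell `i`.
if-elim : ∀ {i j u v w : ℕ} → (i ≡ j → v ≡ u) → (i ≢ j → w ≡ u) → (if i ≡ᵇ j then v else w) ≡ u
if-elim {i} {j} same other with i ≟ j
... | yes i≡j = trans (if-same i≡j) (same i≡j)
... | no  i≢j = trans (if-other i≢j) (other i≢j)

cnt : (ℕ → Bool) → ℕ → ℕ
cnt P zero    = 0
cnt P (suc m) = cnt P m + bit (P m)

bit≤1 : ∀ b → bit b ≤ 1
bit≤1 false = z≤n
bit≤1 true  = ≤-refl

cnt≤ : ∀ P m → cnt P m ≤ m
cnt≤ P zero    = z≤n
cnt≤ P (suc m) = ≤-trans (+-mono-≤ (cnt≤ P m) (bit≤1 (P m))) (≤-reflexive (+-comm m 1))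

cnt-mono : ∀ P {m n} → m ≤ n → cnt P m ≤ cnt P n
cnt-mono P m≤n = go (≤⇒≤′ m≤n)
  where
  go : ∀ {m n} → m ≤′ n → cnt P m ≤ cnt P n
  go ≤′-refl         = ≤-refl
  go (≤′-step m≤′n) = ≤-trans (go m≤′n) (m≤m+n _ _)

cnt-cong : ∀ {P Q} m → (∀ i → i < m → P i ≡ Q i) → cnt P m ≡ cnt Q m
cnt-cong zero    P≗Q = refl
cnt-cong (suc m) P≗Q = cong₂ _+_ (cnt-cong m λ i i<m → P≗Q i (m<n⇒m<1+n i<m)) (cong bit (P≗Q m (n<1+n m)))

cnt-+ : ∀ {P Q R} m → (∀ i → bit (P i) + bit (Q i) ≡ bit (R i)) → cnt P m + cnt Q m ≡ cnt R m
cnt-+ zero    eq = refl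
cnt-+ {P} {Q} (suc m) eq = trans (interchange (cnt P m) (bit (P m)) (cnt Q m) (bit (Q m)))
                                 (cong₂ _+_ (cnt-+ m eq) (eq m))
  where
  interchange : ∀ a b c d → (a + b) + (c + d) ≡ (a + c) + (b + d)
  interchange = solve-∀

without : ℕ → (ℕ → Bool) → ℕ → Bool
without y P z = P z ∧ not (z ≡ᵇ y)

≡ᵇ-refl : ∀ n → (n ≡ᵇ n) ≡ true
≡ᵇ-refl zero    = refl
≡ᵇ-refl (suc n) = ≡ᵇ-refl n

≢⇒≡ᵇ-false : ∀ {i j} → i ≢ j → (i ≡ᵇ j) ≡ false
≢⇒≡ᵇ-false {i} {j} i≢j with i ≡ᵇ j in eq
... | false = refl
... | true  = contradiction (≡ᵇ⇒≡ i j (subst T (sym eq) tt)) i≢j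

without-other : ∀ P {y z} → z ≢ y → without y P z ≡ P z
without-other P {y} {z} z≢y rewrite ≢⇒≡ᵇ-false z≢y with P z
... | true  = refl
... | false = refl

cnt-without : ∀ P {y} n → y < n → P y ≡ true → cnt P n ≡ suc (cnt (without y P) n)
cnt-without P {y} (suc n) y<1+n y∈P with m<1+n⇒m<n∨m≡n y<1+n
... | inj₁ y<n rewrite cnt-without P n y<n y∈P | without-other P {y} {n} (<⇒≢ y<n ∘ sym) = refl
... | inj₂ refl rewrite y∈P | ≡ᵇ-refl y
    | cnt-cong {P} {without y P} y (λ i i<y → sym (without-other P (<⇒≢ i<y)))
  = trans (+-comm (cnt (without y P) y) 1) (cong suc (sym (+-identityʳ (cnt (without y P) y))))

Below : ℕ → ℕ → (ℕ → ℕ) → Set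
Below m n f = ∀ i → i < m → f i < n

InjectiveOn : ℕ → (ℕ → ℕ) → Set
InjectiveOn m f = ∀ i j → i < m → j < m → f i ≡ f j → i ≡ j

-- A counting pigeonhole. When `f m` is counted it is removed from `P`; by injectivity no earlier
-- index notices.
cnt-injective : ∀ P {f n} m → Below m n f → InjectiveOn m f → cnt (P ∘ f) m ≤ cnt P n
cnt-injective P zero f< inj = z≤n
cnt-injective P {f} {n} (suc m) f< inj with P (f m) in fm∈P
... | false = ≤-trans (≤-reflexive (+-identityʳ _))
      (cnt-injective P m (λ i i<m → f< i (m<n⇒m<1+n i<m)) (λ i j i<m j<m → inj i j (m<n⇒m<1+n i<m) (m<n⇒m<1+n j<m)))
... | true = begin
  cnt (P ∘ f) m + 1                 ≡⟨ +-comm _ 1 ⟩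
  suc (cnt (P ∘ f) m)               ≡⟨ cong suc (cnt-cong m λ i i<m → sym (without-other P λ eq →
                                        <⇒≢ i<m (inj i m (m<n⇒m<1+n i<m) (n<1+n m) eq))) ⟩
  suc (cnt (without (f m) P ∘ f) m) ≤⟨ s≤s (cnt-injective (without (f m) P) m
                                        (λ i i<m → f< i (m<n⇒m<1+n i<m)) (λ i j i<m j<m → inj i j (m<n⇒m<1+n i<m) (m<n⇒m<1+n j<m))) ⟩
  suc (cnt (without (f m) P) n)     ≡⟨ cnt-without P n (f< m (n<1+n m)) fm∈P ⟨
  cnt P n                           ∎
  where open ≤-Reasoning

cnt-true : ∀ {P} m → (∀ i → i < m → P i ≡ true) → cnt P m ≡ m
cnt-true zero    all = refl
cnt-true (suc m) all rewrite all m (n<1+n m) | cnt-true m (λ i i<m → all i (m<n⇒m<1+n i<m)) = +-comm m 1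

cnt-false : ∀ {P} m → (∀ i → P i ≡ false) → cnt P m ≡ 0
cnt-false zero    none = refl
cnt-false (suc m) none rewrite none m | cnt-false m none = refl

-- If `y` were missed, all `n` values would lie among the `n` ∸ 1 numbers other than `y`.
injective⇒surjective : ∀ {f n} → Below n n f → InjectiveOn n f → ∀ y → y < n → ∃[ i ] i < n × f i ≡ y
injective⇒surjective {f} {n} f< inj y y<n with anyUpTo? (λ i → f i ≟ y) n
... | yes hit = hit
... | no ¬hit = contradiction (begin-strict
    n                                       ≡⟨ cnt-true n (λ i i<n → without-other (const true) λ eq → ¬hit (i , i<n , eq)) ⟨
    cnt (without y (const true) ∘ f) n      ≤⟨ cnt-injective (without y (const true)) n f< inj ⟩
    cnt (without y (const true)) n          <⟨ n<1+n _ ⟩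
    suc (cnt (without y (const true)) n)    ≡⟨ cnt-without (const true) n y<n refl ⟨
    cnt (const true) n                      ≤⟨ cnt≤ (const true) n ⟩
    n                                       ∎) (n≮n n)
  where open ≤-Reasoning

-- Stable counting sort, lexicographic order and class labels

bit-<ᵇ-suc : ∀ m c → bit (m <ᵇ c) + bit (m ≡ᵇ c) ≡ bit (m <ᵇ suc c)
bit-<ᵇ-suc zero    zero    = refl
bit-<ᵇ-suc zero    (suc c) = refl
bit-<ᵇ-suc (suc m) zero    = refl
bit-<ᵇ-suc (suc m) (suc c) = bit-<ᵇ-suc m c

-- The positions to which a stable counting sort moves the entries of o.
module Rank (n : ℕ) (key o : ℕ → ℕ) where

  below same : ℕ → ℕ
  below c = cnt (λ p → key p <ᵇ c) n
  same  c = cnt (λ p → key p ≡ᵇ c) n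

  before : ℕ → ℕ → ℕ
  before c m = cnt (λ j → key (o j) ≡ᵇ c) m

  pos : ℕ → ℕ
  pos i = below (key (o i)) + before (key (o i)) i

  below-suc : ∀ c → below c + same c ≡ below (suc c)
  below-suc c = cnt-+ n (λ p → bit-<ᵇ-suc (key p) c)

  below-mono : ∀ {c d} → c ≤ d → below c ≤ below d
  below-mono c≤d = go (≤⇒≤′ c≤d)
    where
    go : ∀ {c d} → c ≤′ d → below c ≤ below d
    go ≤′-refl         = ≤-refl
    go (≤′-step {d} c≤′d) = ≤-trans (go c≤′d) (≤-trans (m≤m+n (below d) (same d)) (≤-reflexive (below-suc d)))

  module _ (o< : Below n n o) (o-inj : InjectiveOn n o) where

    -- A bucket never overflows: `before` counts positions, `same` counts states, and `o` injects
    -- the former into the latter.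
    before< : ∀ {i} → i < n → before (key (o i)) i < same (key (o i))
    before< {i} i<n = begin-strict
      before (key (o i)) i       <⟨ n<1+n _ ⟩
      suc (before (key (o i)) i) ≡⟨ +-comm 1 _ ⟩
      before (key (o i)) i + 1   ≡⟨ cong (before (key (o i)) i +_) (if-same {key (o i)} refl) ⟨
      before (key (o i)) (suc i) ≤⟨ cnt-mono _ i<n ⟩
      before (key (o i)) n       ≤⟨ cnt-injective (λ p → key p ≡ᵇ key (o i)) n o< o-inj ⟩
      same (key (o i))           ∎
      where open ≤-Reasoning

    pos<below : ∀ {i} → i < n → pos i < below (suc (key (o i)))
    pos<below {i} i<n = ≤-trans (+-monoʳ-< (below (key (o i))) (before< i<n)) (≤-reflexive (below-suc (key (o i))))

    pos< : Below n n pos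
    pos< i i<n = <-≤-trans (pos<below i<n) (cnt≤ _ n)

    pos-key-< : ∀ {i j} → i < n → key (o i) < key (o j) → pos i < pos j
    pos-key-< {i} {j} i<n lt = <-≤-trans (pos<below i<n) (≤-trans (below-mono lt) (m≤m+n _ _))

    pos-stable : ∀ {i j} → i < j → key (o i) ≡ key (o j) → pos i < pos j
    pos-stable {i} {j} i<j eq rewrite sym eq = +-monoʳ-< (below (key (o i))) (begin-strict
      before (key (o i)) i       <⟨ n<1+n _ ⟩
      suc (before (key (o i)) i) ≡⟨ +-comm 1 _ ⟩
      before (key (o i)) i + 1   ≡⟨ cong (before (key (o i)) i +_) (if-same {key (o i)} refl) ⟨
      before (key (o i)) (suc i) ≤⟨ cnt-mono _ i<j ⟩
      before (key (o i)) j       ∎)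
      where open ≤-Reasoning

    pos-injective : InjectiveOn n pos
    pos-injective i j i<n j<n eq with <-cmp (key (o i)) (key (o j))
    ... | tri< lt _ _ = contradiction eq (<⇒≢ (pos-key-< i<n lt))
    ... | tri> _ _ gt = contradiction (sym eq) (<⇒≢ (pos-key-< j<n gt))
    ... | tri≈ _ key≡ _ with <-cmp i j
    ... | tri< lt _ _ = contradiction eq (<⇒≢ (pos-stable lt key≡))
    ... | tri> _ _ gt = contradiction (sym eq) (<⇒≢ (pos-stable gt (sym key≡)))
    ... | tri≈ _ i≡j _ = i≡j

    -- By trichotomy, new positions follow the key first and the old position second.
    pos-order : ∀ {i j} → j < n → pos i < pos j →
                key (o i) < key (o j) ⊎ key (o i) ≡ key (o j) × i < j
    pos-order {i} {j} j<n lt with <-cmp (key (o i)) (key (o j))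
    ... | tri< klt _ _ = inj₁ klt
    ... | tri> _ _ kgt = contradiction (pos-key-< j<n kgt) (<-asym lt)
    ... | tri≈ _ key≡ _ with <-cmp i j
    ... | tri< i<j _ _ = inj₂ (key≡ , i<j)
    ... | tri> _ _ i>j = contradiction (pos-stable i>j (sym key≡)) (<-asym lt)
    ... | tri≈ _ refl _ = contradiction lt (n≮n (pos i))

    module _ {o′ : ℕ → ℕ} (moved : ∀ i → i < n → o′ (pos i) ≡ o i) where

      pass-below : Below n n o′
      pass-below a a<n with i , i<n , refl ← injective⇒surjective pos< pos-injective a a<n =
        subst (_< n) (sym (moved i i<n)) (o< i i<n)

      pass-injective : InjectiveOn n o′
      pass-injective a b a<n b<n eq
        with i , i<n , refl ← injective⇒surjective pos< pos-injective a a<n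
        with j , j<n , refl ← injective⇒surjective pos< pos-injective b b<n
        = cong pos (o-inj i j i<n j<n (trans (sym (moved i i<n)) (trans eq (moved j j<n))))

      -- The step of radix sort: stability preserves the earlier order among ties, so the new key is
      -- put in front of it lexicographically. Every new position is some `pos i`, which allows the
      -- comparison to be made in the old list.
      pass-sorted : ∀ {_≼_ : ℕ → ℕ → Set} → (∀ i j → i < j → j < n → o i ≼ o j) →
                    ∀ a b → a < b → b < n →
                    key (o′ a) < key (o′ b) ⊎ key (o′ a) ≡ key (o′ b) × o′ a ≼ o′ b
      pass-sorted {_≼_} o-sorted a b a<b b<n
        with i , i<n , refl ← injective⇒surjective pos< pos-injective a (<-trans a<b b<n)
        with j , j<n , refl ← injective⇒surjective pos< pos-injective b b<n
        rewrite moved i i<n | moved j j<n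
        with pos-order j<n a<b
      ... | inj₁ lt          = inj₁ lt
      ... | inj₂ (eq , i<j) = inj₂ (eq , o-sorted i j i<j j<n)

-- The lexicographic order on the components K ∸ (r ∸ 1), …, K.
module Lexicographic (K : ℕ) (key : ℕ → ℕ → ℕ) where

  Lex : ℕ → ℕ → ℕ → Set
  Lex zero    p q = ⊤
  Lex (suc r) p q = key p (K ∸ r) < key q (K ∸ r) ⊎ key p (K ∸ r) ≡ key q (K ∸ r) × Lex r p q

  Same : ℕ → ℕ → Set
  Same p q = ∀ d → d < K + 1 → key p d ≡ key q d

  -- A squeeze: at the first component where `a` and `b` differ, `a` is strictly smaller, and `c`
  -- cannot come back to the value of `a`.
  lex-convex : ∀ r {a b c} → Lex r a b → Lex r b c →
               (∀ d → d < r → key a (K ∸ d) ≡ key c (K ∸ d)) → ∀ d → d < r → key a (K ∸ d) ≡ key b (K ∸ d)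
  lex-convex (suc r) (inj₁ a<b) (inj₁ b<c) same d d<r = contradiction (same r (n<1+n r)) (<⇒≢ (<-trans a<b b<c))
  lex-convex (suc r) (inj₁ a<b) (inj₂ (b≡c , _)) same d d<r =
    contradiction (trans (same r (n<1+n r)) (sym b≡c)) (<⇒≢ a<b)
  lex-convex (suc r) (inj₂ (a≡b , _)) (inj₁ b<c) same d d<r =
    contradiction (trans (sym a≡b) (same r (n<1+n r))) (<⇒≢ b<c)
  lex-convex (suc r) (inj₂ (a≡b , ab)) (inj₂ (_ , bc)) same d d<1+r with m<1+n⇒m<n∨m≡n d<1+r
  ... | inj₂ refl = a≡b
  ... | inj₁ d<r  = lex-convex r ab bc (λ d d<r → same d (m<n⇒m<1+n d<r)) d d<r

  same-convex : ∀ {a b c} → Lex (K + 1) a b → Lex (K + 1) b c → Same a c → Same a b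
  -- `Lex` counts components from `K` downwards; d ↦ K ∸ d translates both ways.
  same-convex {a} {b} ab bc same d d<K+1 = subst (λ d → key a d ≡ key b d) (m∸[m∸n]≡n d≤K)
    (lex-convex (K + 1) ab bc (λ d _ → same (K ∸ d) (≤-<-trans (m∸n≤m K d) K<K+1)) (K ∸ d) (≤-<-trans (m∸n≤m K d) K<K+1))
    where
    K<K+1 : K < K + 1
    K<K+1 = ≤-reflexive (+-comm 1 K)
    d≤K : d ≤ K
    d≤K = s≤s⁻¹ (≤-trans d<K+1 (≤-reflexive (+-comm K 1)))

-- A label that changes whenever S fails between neighbours identifies the
-- classes of S if these are contiguous.
module Labels (S : ℕ → ℕ → Set) (S-refl : ∀ i → S i i) (S-sym : ∀ {i j} → S i j → S j i)
              (S-trans : ∀ {i j l} → S i j → S j l → S i l) where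

  -- `ℓ` is the last label given. `upper` makes ℓ + 1 new, `latest` ties `ℓ` to the preceding
  -- position, and `small` finally puts all labels below the number of positions; `pred` allows for
  -- the initial label 0 before any position is treated.
  record Labelled (lab : ℕ → ℕ) (ℓ j : ℕ) : Set where
    field
      small  : ℓ ≤ pred j
      latest : ∀ i → suc i ≡ j → lab i ≡ ℓ
      upper  : ∀ i → i < j → lab i ≤ ℓ
      same   : ∀ i i′ → i ≤ i′ → i′ < j → (lab i ≡ lab i′ → S i i′) × (S i i′ → lab i ≡ lab i′)

  open Labelled public

  -- Without a fresh label, position `j` joins the class of its predecessor. With one, `upper`
  -- excludes an equal earlier label, and a related earlier `i` would by convexity be related to the
  -- predecessor too, relating it to `j`.
  extend : ∀ {lab lab′ ℓ f} j → Labelled lab ℓ j →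
           (∀ i i′ → i ≤ i′ → suc i′ ≡ j → S i j → S i i′) →
           (∀ i → i < j → lab′ i ≡ lab i) → lab′ j ≡ ℓ + f →
           f ≡ 0 × S j (pred j) ⊎ f ≡ 1 × ¬ S j (pred j) →
           Labelled lab′ (ℓ + f) (suc j)
  extend {lab} {lab′} {ℓ} j L convex old new fresh = record
    { small  = small′ j L fresh
    ; latest = λ { _ refl → new }
    ; upper  = upper′
    ; same   = same′
    }
    where
    small′ : ∀ {lab ℓ f} j → Labelled lab ℓ j → f ≡ 0 × S j (pred j) ⊎ f ≡ 1 × ¬ S j (pred j) → ℓ + f ≤ j
    small′ zero    L (inj₁ (refl , _))    = ≤-trans (≤-reflexive (+-identityʳ _)) (small L)
    -- `pred 0` is 0: the first position is compared with itself and is never fresh.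
    small′ zero    L (inj₂ (_ , distinct)) = contradiction (S-refl 0) distinct
    small′ (suc j) L (inj₁ (refl , _))    = ≤-trans (≤-reflexive (+-identityʳ _)) (m≤n⇒m≤1+n (small L))
    small′ (suc j) L (inj₂ (refl , _))    = ≤-trans (≤-reflexive (+-comm _ 1)) (s≤s (small L))
    upper′ : ∀ i → i < suc j → lab′ i ≤ _
    upper′ i i<1+j with m<1+n⇒m<n∨m≡n i<1+j
    ... | inj₁ i<j  = ≤-trans (≤-reflexive (old i i<j)) (≤-trans (upper L i i<j) (m≤m+n _ _))
    ... | inj₂ refl = ≤-reflexive new
    edge : ∀ {f} i j → Labelled lab ℓ j → (∀ i i′ → i ≤ i′ → suc i′ ≡ j → S i j → S i i′) →
           f ≡ 0 × S j (pred j) ⊎ f ≡ 1 × ¬ S j (pred j) → i < j → (lab i ≡ ℓ + f → S i j) × (S i j → lab i ≡ ℓ + f)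
    edge i (suc j) L convex (inj₁ (refl , sj)) (s≤s i≤j) rewrite +-identityʳ ℓ | sym (latest L j refl) =
      let to , from = same L i j i≤j (n<1+n j) in
      (λ eq → S-trans (to eq) (S-sym sj)) , λ s → from (S-trans s sj)
    edge i (suc j) L convex (inj₂ (refl , distinct)) (s≤s i≤j) =
      (λ eq → contradiction (≤-trans (≤-reflexive (trans (+-comm 1 ℓ) (sym eq))) (upper L i (s≤s i≤j))) 1+n≰n) ,
      λ s → contradiction (S-trans (S-sym s) (convex i j i≤j refl s)) distinct
    same′ : ∀ i i′ → i ≤ i′ → i′ < suc j → (lab′ i ≡ lab′ i′ → S i i′) × (S i i′ → lab′ i ≡ lab′ i′)
    same′ i i′ i≤i′ i′<1+j with m<1+n⇒m<n∨m≡n i′<1+j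
    ... | inj₁ i′<j rewrite old i (≤-<-trans i≤i′ i′<j) | old i′ i′<j = same L i i′ i≤i′ i′<j
    ... | inj₂ refl with m≤n⇒m<n∨m≡n i≤i′
    ... | inj₂ refl = (λ _ → S-refl i) , λ _ → refl
    ... | inj₁ i<j rewrite old i i<j | new = edge i j L convex fresh i<j

-- The subroutines of a round

module M = Moore
open Moore hiding (n; k; p; a; c; i; d)

component-at : Store → ℕ → ℕ → ℕ
component-at σ p d = σ tuple (p * (σ letters 0 + 1) + d)

module _ {K n : ℕ} .{{_ : NonZero n}} where

  scale-n : Scale K 1 n n
  scale-n = begin
    suc n * 1     ≡⟨ *-identityʳ (suc n) ⟩
    1 + n         ≤⟨ +-monoˡ-≤ n (>-nonZero⁻¹ n) ⟩
    n + n         ≡⟨ double n ⟩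
    n * 2         ≤⟨ *-monoʳ-≤ n (m≤m+n 2 K) ⟩
    n * (2 + K)   ∎
    where
    open ≤-Reasoning
    double : ∀ n → n + n ≡ n * 2
    double = solve-∀

  scale-K : ∀ m → Scale K m K m
  scale-K m = ≤-trans (≤-reflexive (*-comm (suc K) m)) (*-monoʳ-≤ m (n≤1+n (suc K)))

  scale-K+1 : ∀ m → Scale K m (K + 1) m
  scale-K+1 m = ≤-reflexive (trans (cong (λ K+1 → suc K+1 * m) (+-comm K 1)) (*-comm (2 + K) m))

  -- Cell c of `bucket` holds successively 0, the size `same c`, the start `below c`, and the next
  -- free position `below c + before c j`. Entry `j` therefore goes to `pos j`.
  bucketSortᵣ : ∀ σ → σ states 0 ≡ n →
    let key = λ p → component-at σ p (σ digit 0); o = σ order in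
    Below n n key → Below n n o → InjectiveOn n o →
    Run K n σ bucketSort (λ τ → ∀ i → i < n → τ order (Rank.pos n key o i) ≡ o i)
  bucketSortᵣ σ states≡ key< o< o-inj =
    forᵣ M.c M.n 1 n (λ j ρ → ∀ c → c < j → ρ bucket c ≡ 0) tt scale-n states≡
      (λ c ())
      (λ j ρ j<n c≡j fr inv → assignᵣ λ c c<1+j → if-elim (λ _ → refl) λ j≢c →
        inv c (≤∧≢⇒< (s≤s⁻¹ c<1+j) λ c≡ → j≢c (trans c≡j (sym c≡))))
      (λ _ _ inv → inv)
    then λ ρ₁ fr₁ zeroed →
    forᵣ M.p M.n 1 n (λ j ρ → ∀ c → c < n → ρ bucket c ≡ cnt (λ p → key p ≡ᵇ c) j) tt scale-n
      (trans (keep fr₁ states 0) states≡)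
      zeroed
      (λ j ρ j<n p≡j fr inv → assignᵣ λ c c<n →
        let at = component-frame ρ j p≡j (λ i → keep (fr₁ ∙ fr) tuple i) (keep (fr₁ ∙ fr) letters 0) (keep (fr₁ ∙ fr) digit 0) in
        if-elim
          (λ eq → trans (cong (_+ 1) (trans (cong (ρ bucket) eq) (inv c c<n)))
                        (sym (cong (cnt (λ p → key p ≡ᵇ c) j +_) (if-same (trans (sym at) eq)))))
          (λ neq → trans (inv c c<n) (sym (trans (cong (cnt (λ p → key p ≡ᵇ c) j +_) (if-other (neq ∘ trans at)))
                                                 (+-identityʳ _)))))
      (λ _ _ inv → inv)
    then λ ρ₂ fr₂ counted →
    assign-then (
    forᵣ M.c M.n 1 n
      -- Buckets before `j` already contain starts, those from `j` on still contain sizes.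
      (λ j ρ → ρ count 0 ≡ R.below j × (∀ c → c < j → ρ bucket c ≡ R.below c) ×
               (∀ c → j ≤ c → c < n → ρ bucket c ≡ R.same c))
      tt scale-n (trans (keep fr₂ states 0) (trans (keep fr₁ states 0) states≡))
      (sym below-0 , (λ c ()) , λ c _ → counted c)
      (λ { j ρ j<n refl fr (inv₁ , inv₂ , inv₃) → assign-then (assign-then (assignᵣ
        ( trans (cong₂ _+_ inv₁ (inv₃ _ ≤-refl j<n)) (R.below-suc _)
        , (λ c c<1+j → if-elim (λ { refl → inv₁ }) λ j≢c → inv₂ c (≤∧≢⇒< (s≤s⁻¹ c<1+j) (j≢c ∘ sym)))
        , (λ c j<c c<n → trans (if-other (<⇒≢ j<c)) (inv₃ c (<⇒≤ j<c) c<n)) ))) })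
      (λ _ _ (_ , inv , _) → inv)
    then λ ρ₃ fr₃ summed →
    forᵣ M.i M.n 1 n
      (λ j ρ → (∀ c → c < n → ρ bucket c ≡ R.below c + R.before c j) ×
               (∀ i → i < j → ρ sorted (R.pos i) ≡ o i))
      tt scale-n (trans (keep fr₃ states 0) (trans (keep fr₂ states 0) (trans (keep fr₁ states 0) states≡)))
      ((λ c c<n → trans (summed c c<n) (sym (+-identityʳ _))) , λ i ())
      (λ j ρ j<n i≡j fr (inv₁ , inv₂) →
        let pj = ρ order (ρ M.i 0)
            pj≡ : pj ≡ o j
            pj≡ = trans (cong (ρ order) i≡j) (trans (keep fr order j) (trans (keep fr₃ order j) (keep (fr₁ ∙ fr₂) order j)))
            c≡ : component-at ρ pj (ρ digit 0) ≡ key (o j)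
            c≡ = component-frame (ρ [ M.p , 0 ↦ pj ]) (o j) pj≡
              (λ i → trans (keep fr tuple i) (trans (keep fr₃ tuple i) (keep (fr₁ ∙ fr₂) tuple i)))
              (trans (keep fr letters 0) (trans (keep fr₃ letters 0) (keep (fr₁ ∙ fr₂) letters 0)))
              (trans (keep fr digit 0) (trans (keep fr₃ digit 0) (keep (fr₁ ∙ fr₂) digit 0)))
            oj<n = o< j j<n
            bucket≡ : ρ bucket (component-at ρ pj (ρ digit 0)) ≡ R.pos j
            bucket≡ = trans (cong (ρ bucket) c≡) (inv₁ _ (key< (o j) oj<n))
        in assign-then (assign-then (assign-then (assignᵣ
          ( (λ c c<n → if-elim
              (λ eq → trans (cong (_+ 1) bucket≡) (trans (+-assoc (R.below (key (o j))) _ 1)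
                 (cong₂ _+_ (cong R.below (trans (sym c≡) eq))
                    (cong₂ _+_ (cong (λ c → R.before c j) (trans (sym c≡) eq)) (sym (if-same (trans (sym c≡) eq)))))))
              (λ neq → trans (inv₁ c c<n) (cong (R.below c +_) (sym (trans (cong (R.before c j +_) (if-other (neq ∘ trans c≡)))
                                                                           (+-identityʳ _))))))
          -- Injectivity of `pos` keeps this write from overwriting an earlier entry.
          , (λ i i<1+j → if-elim
              (λ eq → trans pj≡ (cong o (R.pos-injective o< o-inj j i j<n (<-≤-trans i<1+j j<n) (trans (sym bucket≡) eq))))
              (λ neq → inv₂ i (≤∧≢⇒< (s≤s⁻¹ i<1+j) λ { refl → neq bucket≡ }))) )))))
      (λ _ _ (_ , inv) → inv)
    then λ ρ₄ fr₄ moved →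
    forᵣ M.i M.n 1 n (λ j ρ → ∀ i → i < j → ρ order i ≡ ρ sorted i) tt scale-n
      (trans (keep fr₄ states 0) (trans (keep fr₃ states 0) (trans (keep fr₂ states 0) (trans (keep fr₁ states 0) states≡))))
      (λ i ())
      (λ j ρ j<n i≡j fr inv → assignᵣ λ i i<1+j → if-elim (λ eq → cong (ρ sorted) eq) λ j≢i →
        inv i (≤∧≢⇒< (s≤s⁻¹ i<1+j) λ i≡ → j≢i (trans i≡j (sym i≡))))
      (λ τ fr inv i i<n → trans (inv _ (R.pos< o< o-inj i i<n)) (trans (keep fr sorted _) (moved i i<n))))
    where
    key = λ p → component-at σ p (σ digit 0)
    o = σ order
    module R = Rank n key o
    component-frame : ∀ ρ j → ρ M.p 0 ≡ j → (∀ i → ρ tuple i ≡ σ tuple i) →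
                      ρ letters 0 ≡ σ letters 0 → ρ digit 0 ≡ σ digit 0 →
                      component-at ρ (ρ M.p 0) (ρ digit 0) ≡ key j
    component-frame ρ j p≡ tuple≡ letters≡ digit≡ rewrite p≡ | letters≡ | digit≡ = tuple≡ _
    below-0 : R.below 0 ≡ 0
    below-0 = cnt-false n (λ i → refl)

  record Order (key : ℕ → ℕ → ℕ) (r : ℕ) (o : ℕ → ℕ) : Set where
    field
      below     : Below n n o
      injective : InjectiveOn n o
      ordered   : ∀ i j → i < j → j < n → Lexicographic.Lex K key r (o i) (o j)

  -- After `j` passes the order is lexicographic in the last `j` components; `Lex` is defined so
  -- that `pass-sorted` yields its next instance.
  radixSortᵣ : ∀ σ → σ states 0 ≡ n → σ letters 0 ≡ K →
    (∀ p d → p < n → d < K + 1 → component-at σ p d < n) →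
    Run K n σ radixSort (λ τ → Order (component-at σ) (K + 1) (τ order))
  radixSortᵣ σ states≡ letters≡ key< =
    forᵣ M.i M.n 1 n (λ j ρ → ∀ i → i < j → ρ order i ≡ i) tt scale-n states≡
      (λ i ())
      (λ j ρ j<n i≡j fr inv → assignᵣ λ i i<1+j → if-elim (λ eq → eq) λ j≢i →
        inv i (≤∧≢⇒< (s≤s⁻¹ i<1+j) λ i≡ → j≢i (trans i≡j (sym i≡))))
      (λ _ _ inv → inv)
    then λ ρ₁ fr₁ identity →
    forᵣ M.d (M.k ⊕ lit 1) n (K + 1) (λ j ρ → Order key j (ρ order)) tt (scale-K+1 n)
      (cong (_+ 1) (trans (keep fr₁ letters 0) letters≡))
      record
        { below     = λ i i<n → subst (_< n) (sym (identity i i<n)) i<n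
        ; injective = λ i j i<n j<n eq → trans (sym (identity i i<n)) (trans eq (identity j j<n))
        ; ordered   = λ _ _ _ _ → tt
        }
      (λ j ρ j<K+1 d≡j fr inv →
        let ρ′ = ρ [ digit , 0 ↦ ρ letters 0 ∸ ρ M.d 0 ]
            letters-kept = trans (keep fr letters 0) (keep fr₁ letters 0)
            key′ = λ p → component-at ρ′ p (ρ′ digit 0)
            key≡ : ∀ p → key′ p ≡ key p (K ∸ j)
            key≡ p = trans
              (trans (keep fr tuple _) (keep fr₁ tuple _))
              (cong₂ (λ k d → σ tuple (p * (k + 1) + d)) letters-kept (cong₂ _∸_ (trans letters-kept letters≡) d≡j))
            key<′ : Below n n key′
            key<′ p p<n = subst (_< n) (sym (key≡ p))
              (key< p (K ∸ j) p<n (≤-<-trans (m∸n≤m K j) (≤-reflexive (+-comm 1 K))))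
        in assign-then (weaken
          (bucketSortᵣ ρ′ (trans (keep fr states 0) (trans (keep fr₁ states 0) states≡)) key<′ (Order.below inv) (Order.injective inv))
          λ τ _ moved → record
            { below     = Rank.pass-below n key′ (ρ order) (Order.below inv) (Order.injective inv) moved
            ; injective = Rank.pass-injective n key′ (ρ order) (Order.below inv) (Order.injective inv) moved
            ; ordered   = λ a b a<b b<n → subst₂
                (λ x y → x < y ⊎ x ≡ y × Lexicographic.Lex K key j (τ order a) (τ order b))
                (key≡ (τ order a)) (key≡ (τ order b))
                (Rank.pass-sorted n key′ (ρ order) (Order.below inv) (Order.injective inv) moved
                  {Lexicographic.Lex K key j} (Order.ordered inv) a b a<b b<n)
            }))
      (λ _ _ inv → inv)
    where
    key = component-at σ

  -- Labels are followed along the sorted order, where classes are contiguous by `same-convex`;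
  -- since the order is a permutation, the result holds for all states. `key` is separate because
  -- the sort was stated for the store before it.
  relabelᵣ : ∀ σ key → (∀ p d → component-at σ p d ≡ key p d) →
    σ states 0 ≡ n → σ letters 0 ≡ K → Order key (K + 1) (σ order) →
    let open Lexicographic K key in
    Run K n σ relabel (λ τ → (∀ p → p < n → τ π′ p < n) ×
      (∀ p q → p < n → q < n → (τ π′ p ≡ τ π′ q → Same p q) × (Same p q → τ π′ p ≡ τ π′ q)))
  relabelᵣ σ key key≡ states≡ letters≡ sort = assign-then
    (forᵣ M.i M.n 1 n (λ j ρ → L.Labelled (λ i → ρ π′ (o i)) (ρ label 0) j) tt scale-n states≡
      record { small = z≤n ; latest = λ _ () ; upper = λ _ () ; same = λ _ _ _ () }
      (λ j ρ j<n i≡j fr inv →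
        let oj≡ : ρ order (ρ M.i 0) ≡ o j
            oj≡ = trans (cong (ρ order) i≡j) (keep fr order j)
            oj-1≡ : ρ order (ρ M.i 0 ∸ 1) ≡ o (pred j)
            oj-1≡ = trans (cong (ρ order) (cong pred i≡j)) (keep fr order (pred j))
            component≡ : ∀ p q d → p ≡ q → ρ tuple (p * (ρ letters 0 + 1) + d) ≡ key q d
            component≡ = λ { p q d refl → trans (keep fr tuple _) (trans (cong (λ k → σ tuple (p * (k + 1) + d)) (keep fr letters 0)) (key≡ p d)) }
        in assign-then (
          forᵣ M.d (M.k ⊕ lit 1) 1 (K + 1)
            (λ d ρ → ρ fresh 0 ≡ 0 × (∀ d′ → d′ < d → key (o j) d′ ≡ key (o (pred j)) d′) ⊎
                     ρ fresh 0 ≡ 1 × ¬ S j (pred j))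
            tt (scale-K+1 1) (cong (_+ 1) (trans (keep fr letters 0) letters≡))
            (inj₁ (refl , λ _ ()))
            (λ d ρ₁ d<K+1 d≡ fr₁ inv₁ →
              let x≡ = trans (trans (cong₂ (λ p k → ρ₁ tuple (p * (k + 1) + ρ₁ M.d 0))
                           (trans (cong (ρ₁ order) (keep fr₁ M.i 0)) (keep fr₁ order _)) (keep fr₁ letters 0))
                         (keep fr₁ tuple _)) (component≡ _ _ (ρ₁ M.d 0) oj≡)
                  y≡ = trans (trans (cong₂ (λ p k → ρ₁ tuple (p * (k + 1) + ρ₁ M.d 0))
                           (trans (cong (λ i → ρ₁ order (i ∸ 1)) (keep fr₁ M.i 0)) (keep fr₁ order _)) (keep fr₁ letters 0))
                         (keep fr₁ tuple _)) (component≡ _ _ (ρ₁ M.d 0) oj-1≡)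
              in ifᵣ
                (λ ≢0 → skipᵣ (agree d inv₁ (subst (λ d → key (o j) d ≡ key (o (pred j)) d) d≡
                          (trans (sym x≡) (trans (bit-≡ᵇ-≢0 ≢0) y≡)))))
                (λ ≡0 → assignᵣ (inj₂ (refl , λ s → bit-≡ᵇ-≡0 ≡0
                          (trans x≡ (trans (s _ (subst (_< K + 1) (sym d≡) d<K+1)) (sym y≡)))))))
            (λ _ _ inv → inv)
          then λ ρ₂ fr₂ compared → assign-then (assignᵣ
            (relabelled ρ₂ (ρ₂ order (ρ₂ M.i 0)) (suc j) (sym (keep fr₂ label 0))
              (L.extend j inv (convex j j<n)
                -- `order` is injective, so labelling the current state leaves the earlier labels
                -- intact.
                (λ i i<j → trans (if-other λ eq → <⇒≢ i<j (sym (Order.injective sort j i j<n (<-trans i<j j<n)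
                                    (trans (sym (trans (order₂ ρ₂ fr₂) oj≡)) eq))))
                                 (keep fr₂ π′ (o i)))
                (trans (if-same (trans (order₂ ρ₂ fr₂) oj≡)) (cong (_+ ρ₂ fresh 0) (keep fr₂ label 0)))
                compared)))))
      (λ τ fr labelled → finish τ labelled))
    where
    o = σ order
    open Lexicographic K key
    S : ℕ → ℕ → Set
    S i j = Same (o i) (o j)
    module L = Labels S (λ i d _ → refl) (λ s d d< → sym (s d d<)) (λ s t d d< → trans (s d d<) (t d d<))
    agree : ∀ {j f} d → f ≡ 0 × (∀ d′ → d′ < d → key (o j) d′ ≡ key (o (pred j)) d′) ⊎ f ≡ 1 × ¬ S j (pred j) →
            key (o j) d ≡ key (o (pred j)) d →
            f ≡ 0 × (∀ d′ → d′ < suc d → key (o j) d′ ≡ key (o (pred j)) d′) ⊎ f ≡ 1 × ¬ S j (pred j)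
    agree d (inj₂ distinct)   eq = inj₂ distinct
    agree {j} d (inj₁ (f≡0 , eqs)) eq = inj₁ (f≡0 , λ d′ d′<1+d → new d′ (m<1+n⇒m<n∨m≡n d′<1+d))
      where
      new : ∀ d′ → d′ < d ⊎ d′ ≡ d → key (o j) d′ ≡ key (o (pred j)) d′
      new d′ (inj₁ d′<d) = eqs d′ d′<d
      new d′ (inj₂ refl) = eq
    order₂ : ∀ {s ρ} ρ₂ {i : T (unwritten M.i s)} {u : T (unwritten order s)} → Frame s ρ ρ₂ → ρ₂ order (ρ₂ M.i 0) ≡ ρ order (ρ M.i 0)
    order₂ ρ₂ {i} {u} fr = trans (cong (ρ₂ order) (keep fr M.i {i} 0)) (keep fr order {u} _)
    relabelled : ∀ ρ q j {ℓ ℓ′} → ℓ ≡ ℓ′ →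
      L.Labelled (λ i → if q ≡ᵇ o i then ℓ′ + ρ fresh 0 else ρ π′ (o i)) (ℓ + ρ fresh 0) j →
      L.Labelled (λ i → if q ≡ᵇ o i then ℓ′ + ρ fresh 0 else ρ π′ (o i)) (ℓ′ + ρ fresh 0) j
    relabelled ρ q j refl labelled = labelled
    convex : ∀ j → j < n → ∀ i i′ → i ≤ i′ → suc i′ ≡ j → S i j → S i i′
    convex _ j<n i i′ i≤i′ refl s with m≤n⇒m<n∨m≡n i≤i′
    ... | inj₂ refl = λ _ _ → refl
    ... | inj₁ i<i′ = same-convex (Order.ordered sort i i′ i<i′ (<-trans (n<1+n i′) j<n))
                                  (Order.ordered sort i′ (suc i′) (n<1+n i′) j<n) s
    finish : ∀ τ → L.Labelled (λ i → τ π′ (o i)) (τ label 0) n → (∀ p → p < n → τ π′ p < n) ×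
      (∀ p q → p < n → q < n → (τ π′ p ≡ τ π′ q → Same p q) × (Same p q → τ π′ p ≡ τ π′ q))
    finish τ labelled = bounded , same
      where
      onto = injective⇒surjective (Order.below sort) (Order.injective sort)
      bounded : ∀ p → p < n → τ π′ p < n
      bounded p p<n with i , i<n , refl ← onto p p<n =
        ≤-<-trans (L.upper labelled i i<n) (≤-<-trans (L.small labelled) (≤-reflexive (suc-pred n)))
      same : ∀ p q → p < n → q < n → (τ π′ p ≡ τ π′ q → Same p q) × (Same p q → τ π′ p ≡ τ π′ q)
      same p q p<n q<n with i , i<n , refl ← onto p p<n with j , j<n , refl ← onto q q<n with ≤-total i j
      ... | inj₁ i≤j = L.same labelled i j i≤j j<n
      ... | inj₂ j≤i = let to , from = L.same labelled j i j≤i i<n in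
        (λ eq d d< → sym (to (sym eq) d d<)) , λ s → sym (from λ d d< → sym (s d d<))

value : ℕ → Store → ℕ → ℕ → ℕ
value K σ p zero    = σ π p
value K σ p (suc a) = σ π (σ next (p * K + a))

module _ {K n : ℕ} .{{_ : NonZero n}} where

  -- The rows are written consecutively, so a filled initial segment serves as invariant for both
  -- loops; quotient and remainder by K + 1 recover state and component.
  computeTuplesᵣ : ∀ σ → σ states 0 ≡ n → σ letters 0 ≡ K →
    Run K n σ computeTuples (λ τ → ∀ p c → c < K + 1 → p < n → component-at τ p c ≡ value K σ p c)
  computeTuplesᵣ σ states≡ letters≡ =
    forᵣ M.p M.n 1 n (λ j ρ → Filled (ρ tuple) (j * (K + 1))) tt scale-n states≡
      (λ m ())
      (λ j ρ j<n p≡j fr inv → assign-then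
        (forᵣ M.a M.k 1 K (λ a ρ → Filled (ρ tuple) (suc (j * (K + 1) + a))) tt (scale-K 1)
          (trans (keep fr letters 0) letters≡)
          (subst (Filled _) (cong suc (sym (+-identityʳ _)))
            (fill inv (cong₂ (λ p k → p * (k + 1)) p≡j (trans (keep fr letters 0) letters≡))
              (trans (keep fr π _) (trans (cong (σ π) p≡j)
                (sym (trans (cong target (sym (+-identityʳ (j * (K + 1))))) (target-at j 0 (m≤n+m 1 K))))))))
          (λ a ρ₁ a<K a≡ fr₁ inv₁ → assignᵣ (subst (Filled _) (cong suc (sym (+-suc _ a)))
            (fill inv₁
              (trans (cong₂ (λ p k → p * (k + 1) + (ρ₁ M.a 0 + 1)) (trans (keep fr₁ M.p 0) p≡j)
                        (trans (keep fr₁ letters 0) (trans (keep fr letters 0) letters≡)))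
                     (trans (cong (λ a → j * (K + 1) + (a + 1)) a≡) (trans (cong (j * (K + 1) +_) (+-comm a 1)) (+-suc _ a))))
              (trans (trans (keep fr₁ π _) (keep fr π _))
                (trans (cong (σ π) (trans (keep fr₁ next _) (trans (keep fr next _)
                   (cong (σ next) (cong₂ _+_ (cong₂ _*_ (trans (keep fr₁ M.p 0) p≡j)
                      (trans (keep fr₁ letters 0) (trans (keep fr letters 0) letters≡))) a≡)))))
                (sym (trans (cong target (sym (+-suc (j * (K + 1)) a)))
                   (target-at j (suc a) (<-≤-trans (s≤s a<K) (≤-reflexive (+-comm 1 K)))))))))))
          (λ τ _ inv → subst (Filled (τ tuple)) (next-row K j) inv)))
      (λ τ fr inv p c c<K+1 p<n → trans
        (cong (λ k → τ tuple (p * (k + 1) + c)) (trans (keep fr letters 0) letters≡))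
        (trans (inv _ (index< p c c<K+1 p<n)) (target-at p c c<K+1)))
    where
    target : ℕ → ℕ
    target m = value K σ (m / suc K) (m % suc K)
    Filled : (ℕ → ℕ) → ℕ → Set
    Filled a l = ∀ m → m < l → a m ≡ target m
    target-at : ∀ p c → c < K + 1 → target (p * (K + 1) + c) ≡ value K σ p c
    target-at p c c<K+1 rewrite +-comm K 1 = cong₂ (value K σ)
      (trans (+-distrib-/-∣ˡ c (n∣m*n p)) (trans (cong₂ _+_ (m*n/n≡m p (suc K)) (m<n⇒m/n≡0 c<K+1)) (+-identityʳ p)))
      (trans (cong (_% suc K) (+-comm (p * suc K) c)) (trans ([m+kn]%n≡m%n c p (suc K)) (m<n⇒m%n≡m c<K+1)))
    fill : ∀ {a : ℕ → ℕ} {i l v} → (∀ m → m < l → a m ≡ target m) → i ≡ l → v ≡ target l →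
           ∀ m → m < suc l → (if i ≡ᵇ m then v else a m) ≡ target m
    fill filled refl v≡ m m<1+l = if-elim (λ { refl → v≡ }) λ l≢m → filled m (≤∧≢⇒< (s≤s⁻¹ m<1+l) (l≢m ∘ sym))
    next-row : ∀ K j → suc (j * (K + 1) + K) ≡ suc j * (K + 1)
    next-row = solve-∀
    index< : ∀ p c → c < K + 1 → p < n → p * (K + 1) + c < n * (K + 1)
    index< p c c<K+1 p<n = <-≤-trans (+-monoʳ-< (p * (K + 1)) c<K+1)
      (≤-trans (≤-reflexive (+-comm (p * (K + 1)) (K + 1))) (*-monoˡ-≤ (K + 1) p<n))

  -- For an upper bound on time, the loop has to stop once the partitions agree, whence an
  -- implication in this direction.
  comparePartitionsᵣ : ∀ σ → σ states 0 ≡ n → Run K n σ comparePartitions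
    (λ τ → (∀ p q → p < n → q < n → (σ π p ≡ σ π q → σ π′ p ≡ σ π′ q) × (σ π′ p ≡ σ π′ q → σ π p ≡ σ π q)) →
           τ differ 0 ≡ 0)
  comparePartitionsᵣ σ states≡ =
    -- Cells may be written repeatedly; under `Same` each later write stores the same value.
    forᵣ M.p M.n 1 n (λ j ρ → ∀ q → q < j → Same → ρ forth (σ π q) ≡ σ π′ q × ρ back (σ π′ q) ≡ σ π q) tt scale-n states≡
      (λ q ())
      (λ j ρ j<n p≡j fr inv →
        let π≡ = trans (keep fr π (ρ M.p 0)) (cong (σ π) p≡j)
            π′≡ = trans (keep fr π′ (ρ M.p 0)) (cong (σ π′) p≡j)
        in assign-then (assignᵣ λ q q<1+j same →
          let q<n = <-≤-trans q<1+j j<n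
              old : j ≢ q → _
              old = λ j≢q → inv q (≤∧≢⇒< (s≤s⁻¹ q<1+j) λ { refl → j≢q refl }) same
          in if-elim (λ eq → trans π′≡ (proj₁ (same j q j<n q<n) (trans (sym π≡) eq)))
                     (λ neq → proj₁ (old λ { refl → neq π≡ }))
           , if-elim (λ eq → trans π≡ (proj₂ (same j q j<n q<n) (trans (sym π′≡) eq)))
                     (λ neq → proj₂ (old λ { refl → neq π′≡ }))))
      (λ _ _ inv → inv)
    then λ ρ₁ fr₁ stored → assign-then
    (forᵣ M.p M.n 1 n (λ j ρ → Same → ρ differ 0 ≡ 0) tt scale-n (trans (keep fr₁ states 0) states≡)
      (λ _ → refl)
      (λ j ρ j<n p≡j fr inv →
        let π≡ = trans (keep fr π (ρ M.p 0)) (trans (keep fr₁ π (ρ M.p 0)) (cong (σ π) p≡j))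
            π′≡ = trans (keep fr π′ (ρ M.p 0)) (trans (keep fr₁ π′ (ρ M.p 0)) (cong (σ π′) p≡j))
        in ifᵣ {Q = λ ρ → Same → ρ differ 0 ≡ 0} (λ _ → skipᵣ inv)
               (λ ≡0 → assignᵣ λ same → contradiction
                 (trans (trans (keep fr forth _) (cong (ρ₁ forth) π≡)) (trans (proj₁ (stored j j<n same)) (sym π′≡)))
                 (bit-≡ᵇ-≡0 ≡0))
        then λ ρ₂ fr₂ inv₂ → 
          let π≡₂ = trans (keep fr₂ π (ρ₂ M.p 0)) (trans (cong (ρ π) (keep fr₂ M.p 0)) π≡)
              π′≡₂ = trans (keep fr₂ π′ (ρ₂ M.p 0)) (trans (cong (ρ π′) (keep fr₂ M.p 0)) π′≡)
          in ifᵣ (λ _ → skipᵣ inv₂)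
               (λ ≡0 → assignᵣ λ same → contradiction
                 (trans (trans (keep fr₂ back _) (trans (keep fr back _) (cong (ρ₁ back) π′≡₂))) (trans (proj₂ (stored j j<n same)) (sym π≡₂)))
                 (bit-≡ᵇ-≡0 ≡0)))
      (λ _ _ inv → inv))
    where
    Same = ∀ p q → p < n → q < n → (σ π p ≡ σ π q → σ π′ p ≡ σ π′ q) × (σ π′ p ≡ σ π′ q → σ π p ≡ σ π q)

-- The program on a given automaton

cells-lookup : ∀ {m} (v : Vec ℕ m) i → cells (Vec.toList v) (toℕ i) ≡ lookup v i
cells-lookup (x ∷ v) zero    = refl
cells-lookup (x ∷ v) (suc i) = cells-lookup v i

lookup-concat : ∀ {A : Set} {m k} (rows : Vec (Vec A k) m) i j →
                lookup (Vec.concat rows) (combine i j) ≡ lookup (lookup rows i) j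
lookup-concat {k = k} (row ∷ rows) zero    j = lookup-++ˡ row (Vec.concat rows) j
lookup-concat {k = k} (row ∷ rows) (suc i) j =
  trans (lookup-++ʳ row (Vec.concat rows) (combine i j)) (lookup-concat rows i j)

at-toℕ : ∀ {n} (P : ℕ → Set) → (∀ (i : Fin n) → P (toℕ i)) → ∀ i → i < n → P i
at-toℕ P all i i<n = subst P (toℕ-fromℕ< i<n) (all (fromℕ< i<n))

bit-injective : ∀ {b c} → bit b ≡ bit c → b ≡ c
bit-injective {false} {false} _ = refl
bit-injective {true}  {true}  _ = refl

-- The body of the main loop, which Moore does not name.
round : Stmt
round = body mainLoop
  where
  body : Stmt → Stmt
  body (_ ⨟ while _ loop s) = s
  body s                    = s

module Correctness {K n : ℕ} (𝒜 : Automaton K n) where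

  open Automaton 𝒜 using (δ; start; final; _·_)
  open MooreEquivalence _·_

  instance
    n≢0 : NonZero n
    n≢0 = >-nonZero (≤-<-trans z≤n (toℕ<n start))

  record Input (σ : Store) : Set where
    field
      states≡  : σ states 0 ≡ n
      letters≡ : σ letters 0 ≡ K
      next≡    : ∀ p a → σ next (toℕ p * K + toℕ a) ≡ toℕ (p · a)
      isFinal≡ : ∀ p → σ isFinal (toℕ p) ≡ bit (lookup final p)
  open Input

  Input-frame : ∀ {s σ τ} {u₀ : T (unwritten states s)} {u₁ : T (unwritten letters s)}
                {u₂ : T (unwritten next s)} {u₄ : T (unwritten isFinal s)} → Frame s σ τ → Input σ → Input τ
  Input-frame {u₀ = u₀} {u₁} {u₂} {u₄} fr input = record
    { states≡  = trans (keep fr states {u₀} 0) (states≡ input)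
    ; letters≡ = trans (keep fr letters {u₁} 0) (letters≡ input)
    ; next≡    = λ p a → trans (keep fr next {u₂} _) (next≡ input p a)
    ; isFinal≡ = λ p → trans (keep fr isFinal {u₄} _) (isFinal≡ input p)
    }

  Input-update : ∀ x v {σ} {u₀ : T (not (x ≡ᵇ states))} {u₁ : T (not (x ≡ᵇ letters))}
                 {u₂ : T (not (x ≡ᵇ next))} {u₄ : T (not (x ≡ᵇ isFinal))} → Input σ → Input (σ [ x , 0 ↦ v ])
  Input-update x v {σ} {u₀ = u₀} {u₁} {u₂} {u₄} =
    Input-frame {u₀ = u₀} {u₁} {u₂} {u₄} (mkFrame {x ≔ lit v} λ y u i → update-frame σ x 0 v y i u)

  Input-load : Input (load 𝒜)
  Input-load = record
    { states≡  = refl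
    ; letters≡ = refl
    ; next≡    = λ p a → trans
        (cong (cells (Vec.toList (Vec.map toℕ (Vec.concat δ))))
              (trans (cong (_+ toℕ a) (*-comm (toℕ p) K)) (sym (toℕ-combine p a))))
        (trans (cells-lookup (Vec.map toℕ (Vec.concat δ)) (combine p a))
          (trans (lookup-map (combine p a) toℕ (Vec.concat δ)) (cong toℕ (lookup-concat δ p a))))
    ; isFinal≡ = λ p → trans (cells-lookup (Vec.map bit final) p) (lookup-map p bit final)
    }

  record Represents (label : ℕ → ℕ) (t : ℕ) : Set where
    field
      label<   : ∀ (p : Fin n) → label (toℕ p) < n
      sound    : ∀ p q → label (toℕ p) ≡ label (toℕ q) → E final t p q
      complete : ∀ p q → E final t p q → label (toℕ p) ≡ label (toℕ q)
  open Represents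

  value< : ∀ σ {t} → Input σ → Represents (σ π) t → ∀ p c → p < n → c < K + 1 → value K σ p c < n
  value< σ input rep p c p<n c<K+1 = at-toℕ (λ p → value K σ p c < n) (λ p → at c (subst (c <_) (+-comm K 1) c<K+1) p) p p<n
    where
    at : ∀ c → c < suc K → ∀ p → value K σ (toℕ p) c < n
    at zero    _         p = label< rep p
    at (suc a) (s≤s a<K) p = at-toℕ (λ a → value K σ (toℕ p) (suc a) < n)
      (λ a → subst (λ q → σ π q < n) (sym (next≡ input p a)) (label< rep (p · a))) a a<K

  -- Component 0 of the tuples compares the states themselves and component a + 1 their successors
  -- under a, which is the recursion defining `E`.
  refine : ∀ σ {t} → Input σ → Represents (σ π) t → ∀ p q →
    ((∀ d → d < K + 1 → value K σ (toℕ p) d ≡ value K σ (toℕ q) d) → E final (suc t) p q) ×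
    (E final (suc t) p q → ∀ d → d < K + 1 → value K σ (toℕ p) d ≡ value K σ (toℕ q) d)
  refine σ {t} input rep p q = to , from
    where
    value≡ : ∀ p a → value K σ (toℕ p) (suc (toℕ a)) ≡ σ π (toℕ (p · a))
    value≡ p a = cong (σ π) (next≡ input p a)
    to : (∀ d → d < K + 1 → value K σ (toℕ p) d ≡ value K σ (toℕ q) d) → E final (suc t) p q
    to same = sound rep p q (same 0 (m≤n+m 1 K)) , λ a → sound rep (p · a) (q · a)
      (trans (sym (value≡ p a)) (trans (same (suc (toℕ a)) (subst (suc (toℕ a) <_) (+-comm 1 K) (s≤s (toℕ<n a)))) (value≡ q a)))
    from : E final (suc t) p q → ∀ d → d < K + 1 → value K σ (toℕ p) d ≡ value K σ (toℕ q) d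
    from (e , es) d d<K+1 = at d (subst (d <_) (+-comm K 1) d<K+1)
      where
      at : ∀ d → d < suc K → value K σ (toℕ p) d ≡ value K σ (toℕ q) d
      at zero    _         = complete rep p q e
      at (suc a) (s≤s a<K) = at-toℕ (λ a → value K σ (toℕ p) (suc a) ≡ value K σ (toℕ q) (suc a))
        (λ a → trans (value≡ p a) (trans (complete rep (p · a) (q · a) (es a)) (sym (value≡ q a)))) a a<K

  -- The round moves level `t` to `π` and computes level `suc t` in `π′`. The finer level always
  -- implies the coarser; stability gives the converse, so the comparison finds no difference.
  roundᵣ : ∀ σ t → Input σ → Represents (σ π′) t →
           Run K n σ round (λ τ → Input τ × Represents (τ π′) (suc t) × (Stable final t → τ differ 0 ≡ 0))
  roundᵣ σ t input rep =
    forᵣ M.p M.n 1 n (λ j ρ → ∀ i → i < j → ρ π i ≡ σ π′ i) tt scale-n (states≡ input)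
      (λ i ())
      (λ j ρ j<n p≡j fr inv → assignᵣ λ i i<1+j → if-elim
        (λ eq → trans (keep fr π′ _) (cong (σ π′) eq))
        (λ j≢i → inv i (≤∧≢⇒< (s≤s⁻¹ i<1+j) λ i≡ → j≢i (trans p≡j (sym i≡)))))
      (λ _ _ inv → inv)
    then λ ρ₁ fr₁ copied →
      let input₁ = Input-frame fr₁ input
          rep₁   = record
            { label<   = λ p → subst (_< n) (sym (copied (toℕ p) (toℕ<n p))) (label< rep p)
            ; sound    = λ p q eq → sound rep p q (trans (sym (copied (toℕ p) (toℕ<n p))) (trans eq (copied (toℕ q) (toℕ<n q))))
            ; complete = λ p q e → trans (copied (toℕ p) (toℕ<n p)) (trans (complete rep p q e) (sym (copied (toℕ q) (toℕ<n q))))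
            }
      in computeTuplesᵣ ρ₁ (states≡ input₁) (letters≡ input₁)
    then λ ρ₂ fr₂ tuples →
      let input₂ = Input-frame fr₂ input₁
          key<   = λ p d p<n d<K+1 → subst (_< n) (sym (tuples p d d<K+1 p<n)) (value< ρ₁ input₁ rep₁ p d p<n d<K+1)
      in radixSortᵣ ρ₂ (states≡ input₂) (letters≡ input₂) key<
    then λ ρ₃ fr₃ sort →
      let input₃ = Input-frame fr₃ input₂
      in relabelᵣ ρ₃ (component-at ρ₂)
           (λ p d → trans (keep fr₃ tuple _) (cong (λ k → ρ₂ tuple (p * (k + 1) + d)) (keep fr₃ letters 0)))
           (states≡ input₃) (letters≡ input₃) sort
    then λ { ρ₄ fr₄ (label<₄ , same₄) →
      let input₄ = Input-frame fr₄ input₃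
          π≡ : ∀ p → ρ₄ π p ≡ ρ₁ π p
          π≡ p = trans (keep fr₄ π p) (trans (keep fr₃ π p) (keep fr₂ π p))
          rep₄ : Represents (ρ₄ π′) (suc t)
          rep₄ = record
            { label<   = λ p → label<₄ (toℕ p) (toℕ<n p)
            ; sound    = λ p q eq → proj₁ (refine ρ₁ input₁ rep₁ p q) λ d d< →
                trans (sym (tuples (toℕ p) d d< (toℕ<n p)))
                  (trans (proj₁ (same₄ (toℕ p) (toℕ q) (toℕ<n p) (toℕ<n q)) eq d d<) (tuples (toℕ q) d d< (toℕ<n q)))
            ; complete = λ p q e → proj₂ (same₄ (toℕ p) (toℕ q) (toℕ<n p) (toℕ<n q)) λ d d< →
                trans (tuples (toℕ p) d d< (toℕ<n p))
                  (trans (proj₂ (refine ρ₁ input₁ rep₁ p q) e d d<) (sym (tuples (toℕ q) d d< (toℕ<n q))))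
            }
          agree : Stable final t → ∀ p q → p < n → q < n →
                  (ρ₄ π p ≡ ρ₄ π q → ρ₄ π′ p ≡ ρ₄ π′ q) × (ρ₄ π′ p ≡ ρ₄ π′ q → ρ₄ π p ≡ ρ₄ π q)
          agree = λ st p q p<n q<n →
            at-toℕ (λ p → (ρ₄ π p ≡ ρ₄ π q → ρ₄ π′ p ≡ ρ₄ π′ q) × (ρ₄ π′ p ≡ ρ₄ π′ q → ρ₄ π p ≡ ρ₄ π q)) (λ p →
              at-toℕ (λ q → (ρ₄ π (toℕ p) ≡ ρ₄ π q → ρ₄ π′ (toℕ p) ≡ ρ₄ π′ q) × (ρ₄ π′ (toℕ p) ≡ ρ₄ π′ q → ρ₄ π (toℕ p) ≡ ρ₄ π q)) (λ q →
                (λ eq → complete rep₄ p q (st p q (sound rep₁ p q (trans (sym (π≡ _)) (trans eq (π≡ _)))))) ,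
                (λ eq → trans (π≡ _) (trans (complete rep₁ p q (proj₁ (sound rep₄ p q eq))) (sym (π≡ _)))))
              q q<n) p p<n
      in weaken (comparePartitionsᵣ ρ₄ (states≡ input₄)) λ τ fr₅ compared →
           Input-frame fr₅ input₄ ,
           record
             { label<   = λ p → subst (_< n) (sym (keep fr₅ π′ _)) (label< rep₄ p)
             ; sound    = λ p q eq → sound rep₄ p q (trans (sym (keep fr₅ π′ _)) (trans eq (keep fr₅ π′ _)))
             ; complete = λ p q e → trans (keep fr₅ π′ _) (trans (complete rep₄ p q e) (sym (keep fr₅ π′ _)))
             } ,
           λ st → compared (agree st) }

  module _ (s : ℕ) (s-stable : Stable final s) where

    scale : ℕ
    scale = n * suc s

    instance
      scale≢0 : NonZero scale
      scale≢0 = m*n≢0 n (suc s)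

    -- `t` rounds are done and `r` are still allowed. Stability at `s` is noticed by the round that
    -- computes level `suc s`, hence `suc s` rounds in all.
    Remaining : ℕ → Store → Set
    Remaining r σ = Σ[ t ∈ ℕ ] r + t ≡ suc s × Input σ × Represents (σ π′) t × (r ≡ 0 → σ differ 0 ≡ 0)

    mainLoopᵣ : ∀ σ → Input σ → Represents (σ π′) 0 → Run K scale σ mainLoop Input
    mainLoopᵣ σ input rep = assign-then (whileᵣ {m = n} (suc s) Remaining
      (λ { ρ (t , _ , _ , _ , done) → done refl })
      (λ { r ρ (t , r+t≡ , input , rep , _) → weaken (roundᵣ ρ t input rep) λ { τ _ (input′ , rep′ , stop) →
         suc t , trans (+-suc r t) r+t≡ , input′ , rep′ ,
         λ { refl → stop (subst (Stable final) (sym (suc-injective r+t≡)) s-stable) } } })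
      (0 , +-identityʳ (suc s) , Input-update differ 1 input , rep , λ ())
      (λ { r τ (_ , _ , input , _) → input }))

    scale-n-scale : Scale K 1 n scale
    scale-n-scale = ≤-trans (scale-n {K} {n}) (*-monoˡ-≤ (2 + K) (m≤m*n n (suc s)))

    oneStateᵣ : ∀ b σ → Input σ → Run K scale σ (oneState b) (const ⊤)
    oneStateᵣ b σ input = assign-then (assign-then
      (forᵣ M.a M.k scale K (λ _ _ → ⊤) tt (scale-K {K} {n} scale) (letters≡ input) tt
        (λ _ _ _ _ _ _ → assignᵣ tt) (λ _ _ _ → tt)
      then λ _ _ _ → assignᵣ tt))

    quotientᵣ : ∀ σ → Input σ → Run K scale σ quotient (const ⊤)
    quotientᵣ σ input = assign-then (assign-then
      (forᵣ M.p M.n 1 n (λ _ _ → ⊤) tt scale-n-scale (states≡ input) tt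
        (λ j ρ j<n p≡j fr _ → assign-then
          (forᵣ M.a M.k 1 K (λ _ _ → ⊤) tt (scale-K {K} {n} 1) (trans (keep fr letters 0) (letters≡ input)) tt
            (λ _ _ _ _ _ _ → assignᵣ tt) (λ _ _ _ → tt)))
        (λ _ _ _ → tt)))

    mooreᵣ : Run K scale (load 𝒜) moore (const ⊤)
    mooreᵣ = assign-then
      (forᵣ M.p M.n 1 n (λ j ρ → ρ count 0 ≤ j) tt scale-n-scale refl z≤n
        (λ j ρ j<n p≡j fr inv → assignᵣ (≤-trans
          (+-mono-≤ inv (subst (_≤ 1) (sym (trans (keep fr isFinal _) (cong (load 𝒜 isFinal) p≡j))) (isFinal≤1 j j<n)))
          (≤-reflexive (+-comm j 1))))
        (λ _ _ inv → inv)
      then λ ρ fr count≤ →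
        let input = Input-frame fr (Input-update count 0 Input-load)
        in ifᵣ (λ _ → oneStateᵣ 0 ρ input) λ ≡0 → ifᵣ (λ _ → oneStateᵣ 1 ρ input) λ ≡0′ →
        -- The initial labels 0 and 1 must be below `n` to index buckets; a count strictly between 0
        -- and `n` forces `n` ≥ 2.
        let 2≤n = <-≤-trans (s≤s (n≢0⇒n>0 (bit-≡ᵇ-≡0 ≡0)))
                            (≤∧≢⇒< count≤ (λ eq → bit-≡ᵇ-≡0 ≡0′ (trans eq (sym (states≡ input)))))
        in forᵣ M.p M.n 1 n (λ j ρ′ → ∀ i → i < j → ρ′ π′ i ≡ ρ isFinal i) tt scale-n-scale (states≡ input)
             (λ i ())
             (λ j ρ′ j<n p≡j fr′ inv → assignᵣ λ i i<1+j → if-elim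
               (λ eq → trans (keep fr′ isFinal _) (cong (ρ isFinal) eq))
               (λ j≢i → inv i (≤∧≢⇒< (s≤s⁻¹ i<1+j) λ i≡ → j≢i (trans p≡j (sym i≡)))))
             (λ _ _ inv → inv)
           then λ ρ₁ fr₁ copied →
             let π′≡ : ∀ p → ρ₁ π′ (toℕ p) ≡ bit (lookup final p)
                 π′≡ p = trans (copied (toℕ p) (toℕ<n p)) (isFinal≡ input p)
             in mainLoopᵣ ρ₁ (Input-frame fr₁ input) record
               { label<   = λ p → subst (_< n) (sym (π′≡ p)) (<-≤-trans (s≤s (bit≤1 (lookup final p))) 2≤n)
               ; sound    = λ p q eq → bit-injective (trans (sym (π′≡ p)) (trans eq (π′≡ q)))
               ; complete = λ p q e → trans (π′≡ p) (trans (cong bit e) (sym (π′≡ q)))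
               }
           then λ ρ₂ _ input₂ → quotientᵣ ρ₂ input₂)
      where
      isFinal≤1 : ∀ j → j < n → load 𝒜 isFinal j ≤ 1
      isFinal≤1 = at-toℕ (λ j → load 𝒜 isFinal j ≤ 1)
        λ p → subst (_≤ 1) (sym (isFinal≡ Input-load p)) (bit≤1 (lookup final p))

-- The running time and its average

open Run

module _ {k : ℕ} where

  𝒲 : ∀ n → Automaton k n → ℕ
  𝒲 n 𝒜 = time (mooreᵣ n (stable-at-n final))
    where
    open Correctness 𝒜
    open Automaton 𝒜 using (final; _·_)
    open MooreEquivalence _·_

  𝒲-isRunningTime : IsMooreRunningTime 𝒲
  𝒲-isRunningTime n 𝒜 = end moore⇓ , derivation moore⇓
    where
    open Correctness 𝒜
    open Automaton 𝒜 using (final; _·_)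
    open MooreEquivalence _·_
    moore⇓ = mooreᵣ n (stable-at-n final)

  -- `𝒲` is read off the derivation for the always stable level `n`. Another stable level gives a
  -- derivation of the same program with another bound, and determinism makes the two times equal.
  𝒲≤ : ∀ {n} (𝒜 : Automaton k n) s → MooreEquivalence.Stable (Automaton._·_ 𝒜) (Automaton.final 𝒜) s →
       𝒲 n 𝒜 ≤ n * suc s * bound k moore
  𝒲≤ {n} 𝒜 s stable = ≤-trans
    (≤-reflexive (proj₁ (deterministic (proj₂ (𝒲-isRunningTime n 𝒜)) (derivation moore⇓)))) (fast moore⇓)
    where
    moore⇓ = Correctness.mooreᵣ 𝒜 s stable

theorem3p1 : (k : ℕ) → 1 ≤ k →
  Σ[ 𝒲 ∈ ((n : ℕ) → Automaton k n → ℕ) ]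
    IsMooreRunningTime 𝒲 ×
    ((λ n → average (𝒲 n) (accessibleAutomata k n)) =O (λ n → n * ⌊log₂ n ⌋))
theorem3p1 k _ = 𝒲 , 𝒲-isRunningTime , average-bound 𝒲 (bound k moore)
  λ n t δ q₀ F → let open MooreEquivalence (λ p a → lookup (lookup δ p) a) in
    𝒲≤ (automaton δ q₀ F) (rounds t F) (rounds-stable t F)
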